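{- Let $n\geq 2$ be an integer and let $\varepsilon>0$. There exists a Jordan-measurable set $A\subseteq\mathbb{R}^n$ (i.e., a set whose boundary has Lebesgue measure $0$) of infinite volume such that every $n$-dimensional parallelotope with all $2^n$ vertices in $A$ has volume less than $\varepsilon$.
   Context: An $n$-dimensional parallelotope in $\mathbb{R}^n$ has vertices $p+\sum_{j\in T}v_j$, $T\subseteq\{1,\ldots,n\}$, where $p\in\mathbb{R}^n$ and $v_1,\ldots,v_n\in\mathbb{R}^n$ are linearly independent; its volume is $|\det(v_1,\ldots,v_n)|$. -}

module Defs where

open import Algebra.Bundles using (CommutativeRing)
open import Data.Bool.Base using (if_then_else_)
open import Data.Fin.Base using (zero; suc; toℕ)
open import Data.Fin.Subset using (Subset)
open import Data.Nat.Base using (ℕ; zero; suc)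
open import Data.Product.Base using (∃-syntax; _×_)
open import Data.Vec.Base using (lookup)
open import Data.Vec.Functional using (Vector; removeAt; transpose)
open import Function.Base using (flip)
open import Level using (0ℓ) renaming (suc to lsuc)
open import Relation.Binary.Core using (Rel)
open import Relation.Binary.PropositionalEquality.Core using (_≡_)
open import Relation.Binary.Structures using (IsStrictTotalOrder)
open import Relation.Nullary.Construct.Add.Supremum using (_⁺; ⊤⁺; [_])
open import Relation.Nullary.Decidable.Core using (does)
open import Relation.Nullary.Negation.Core using (¬_)
open import Relation.Unary using (Pred; _∈_; _⊆_; ∁; _≬_; Satisfiable)
import Algebra.Properties.CommutativeMonoid.Sum as MonoidSum
import Algebra.Properties.Semiring.Exp as Exp
import Data.Vec.Functional.Relation.Binary.Equality.Setoid as VectorEquality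
import Relation.Binary.Construct.Add.Supremum.NonStrict as AddSupremum
import Relation.Binary.Construct.StrictToNonStrict as StrictToNonStrict

module _ {A : Set} (_≤_ : Rel A 0ℓ) where

  UpperBound : Pred A 0ℓ → Pred A 0ℓ
  UpperBound S u = ∀ x → x ∈ S → x ≤ u

  IsSupremum : Pred A 0ℓ → Pred A 0ℓ
  IsSupremum S s = UpperBound S s × (∀ u → UpperBound S u → s ≤ u)

IsInfimum : {A : Set} → Rel A 0ℓ → Pred A 0ℓ → Pred A 0ℓ
IsInfimum _≤_ = IsSupremum (flip _≤_)

-- Classically, ℝ is up to isomorphism the only complete ordered field.  The
-- equality _≈_ is an arbitrary setoid equality, so that Cauchy sequences of
-- rationals are (given excluded middle) a model.
record CompleteOrderedField : Set (lsuc 0ℓ) where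
  infix 4 _<_ _≤_

  field
    commutativeRing : CommutativeRing 0ℓ 0ℓ

  open CommutativeRing commutativeRing public

  field
    _<_                : Rel Carrier 0ℓ
    isStrictTotalOrder : IsStrictTotalOrder _≈_ _<_
    0≉1                : ¬ (0# ≈ 1#)
    inverse            : ∀ x → ¬ (x ≈ 0#) → ∃[ y ] x * y ≈ 1#
    +-monoˡ-<          : ∀ z {x y} → x < y → x + z < y + z
    *-pos              : ∀ {x y} → 0# < x → 0# < y → 0# < x * y

  _≤_ : Rel Carrier 0ℓ
  _≤_ = StrictToNonStrict._≤_ _≈_ _<_

  field
    complete : (S : Pred Carrier 0ℓ) → Satisfiable S →
               Satisfiable (UpperBound _≤_ S) → Satisfiable (IsSupremum _≤_ S)

module Euclidean (R : CompleteOrderedField) where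

  open CompleteOrderedField R public hiding (zero) renaming (Carrier to ℝ)
  open IsStrictTotalOrder isStrictTotalOrder public using (_<?_)
  open VectorEquality setoid public using (_≋_)
  open MonoidSum +-commutativeMonoid public using (sum)
  open MonoidSum *-commutativeMonoid public using () renaming (sum to product)
  open Exp semiring public using (_^_)

  ∣_∣ : ℝ → ℝ
  ∣ x ∣ = if does (x <? 0#) then - x else x

  -- ℝ with a point +∞ added.
  ℝ⁺ : Set
  ℝ⁺ = ℝ ⁺

  +∞ : ℝ⁺
  +∞ = ⊤⁺

  open AddSupremum _≤_ public using (_≤⁺_)

  Point : ℕ → Set
  Point n = Vector ℝ n

  -- A predicate is a set of points only if it also respects _≋_.
  PointSet : ℕ → Set (lsuc 0ℓ)
  PointSet n = Pred (Point n) 0ℓ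

  -- The open Euclidean ball of radius r; used for r > 0 only.
  Ball : ∀ {n} → Point n → ℝ → PointSet n
  Ball x r y = sum (λ i → (y i - x i) * (y i - x i)) < r * r

  Interior : ∀ {n} → PointSet n → PointSet n
  Interior A x = ∃[ r ] 0# < r × Ball x r ⊆ A

  Closure : ∀ {n} → PointSet n → PointSet n
  Closure A x = ∀ r → 0# < r → Ball x r ≬ A

  Boundary : ∀ {n} → PointSet n → PointSet n
  Boundary A x = x ∈ Closure A × x ∈ ∁ (Interior A)

  -- A closed, possibly degenerate, box.
  record Box (n : ℕ) : Set where
    field
      lower upper : Point n
      lower≤upper : ∀ i → lower i ≤ upper i

    Inside : PointSet n
    Inside x = ∀ i → lower i ≤ x i × x i ≤ upper i

    boxVolume : ℝ
    boxVolume = product (λ i → upper i - lower i)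

  open Box public using (Inside; boxVolume)

  Covers : ∀ {n} → (ℕ → Box n) → PointSet n → Set
  Covers B A = ∀ x → x ∈ A → ∃[ k ] x ∈ Inside (B k)

  partialVolume : ∀ {n} → (ℕ → Box n) → ℕ → ℝ
  partialVolume B m = sum {m} (λ k → boxVolume (B (toℕ k)))

  -- The value in [0,+∞] of the series of volumes.
  TotalVolume : ∀ {n} → (ℕ → Box n) → ℝ⁺ → Set
  TotalVolume B = IsSupremum _≤⁺_ (λ s → ∃[ m ] s ≡ [ partialVolume B m ])

  -- Lebesgue outer measure, as a relation between a set and its value.  On
  -- Lebesgue measurable sets, in particular on null sets and on sets with null
  -- boundary, it is Lebesgue measure.
  LebesgueMeasure : ∀ {n} → PointSet n → ℝ⁺ → Set
  LebesgueMeasure A =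
    IsInfimum _≤⁺_ (λ t → ∃[ B ] Covers B A × TotalVolume B t)

  JordanMeasurable : ∀ {n} → PointSet n → Set
  JordanMeasurable A = LebesgueMeasure (Boundary A) [ 0# ]

  InfiniteVolume : ∀ {n} → PointSet n → Set
  InfiniteVolume A = LebesgueMeasure A +∞

  LinearlyIndependent : ∀ {n k} → Vector (Point n) k → Set
  LinearlyIndependent {k = k} v =
    ∀ (c : Vector ℝ k) → (∀ i → sum (λ j → c j * v j i) ≈ 0#) → ∀ j → c j ≈ 0#

  -- Laplace expansion along the first row; M i j is the entry in row i and
  -- column j.
  det : ∀ {n} → Vector (Vector ℝ n) n → ℝ
  det {zero}  M = 1#
  det {suc n} M =
    sum (λ j → (- 1#) ^ toℕ j * M zero j * det (λ i → removeAt (M (suc i)) j))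

  record Parallelotope (n : ℕ) : Set where
    field
      base        : Point n
      edge        : Vector (Point n) n
      independent : LinearlyIndependent edge

    vertex : Subset n → Point n
    vertex T i = base i + sum (λ j → if lookup T j then edge j i else 0#)

    volume : ℝ
    volume = ∣ det (transpose edge) ∣

  open Parallelotope public using (vertex; volume)

module Submission where

-- The witness is a staircase under a hyperbola: the union over j of the boxes
--   [2ʲ, 2ʲ⁺¹] × [0, c/2ʲ⁺¹] × [0,1]ⁿ⁻²,
-- each of volume c/2.  On it x₀ ≥ 0, x₁ ≥ 0 and x₀ x₁ ≤ c.  If v and w are two
-- edges of a parallelotope with vertices in it, then some edge parallel to w
-- has both its ends at x₀ ≥ |v₀|, so |v₀ w₁| ≤ c; all further coordinates of
-- the edges are at most 1, and Laplace expansion along the first two rows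
-- bounds the volume by c n!, so c is chosen with c n! < ε.
--
-- That a box cannot be covered by boxes of smaller total volume is proved
-- without passing to open covers.  Call a box deficient if the boxes B k of the
-- cover meet it in a total volume bounded by some s smaller than its own.  When
-- a deficient box is cut by a hyperplane, one of the pieces is deficient.
-- Cutting along the facets of B k therefore gives a deficient piece that is
-- contained in B k, which is absurd, or lies beyond a facet of B k; since s is
-- strictly smaller than the volume, the latter can be shrunk to be disjoint
-- from B k.  Doing so for every k yields nested boxes whose common point is
-- not covered.

open import Algebra.Bundles using (CommutativeRing)
open import Algebra.Solver.Ring.AlmostCommutativeRing
  using (fromCommutativeRing; _-Raw-AlmostCommutative⟶_)
open import Axiom.ExcludedMiddle using (ExcludedMiddle)
open import Data.Bool.Base using (if_then_else_)
open import Data.Empty using (⊥-elim)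
open import Data.Fin.Base using (Fin; zero; suc; toℕ; fromℕ<; punchIn; combine; remQuot)
open import Data.Fin.Patterns using (0F; 1F)
open import Data.Fin.Properties as Fin
  using (punchInᵢ≢i; remQuot-combine; toℕ<n; fromℕ<-cong; fromℕ<-toℕ; toℕ-fromℕ<)
open import Data.Fin.Subset using (Subset; ⊥; inside; outside)
open import Data.Integer.Base as ℤ using (ℤ; -[1+_]; _⊖_)
open import Data.Maybe.Base using (Maybe; just; nothing)
open import Data.Nat.Base as ℕ using (ℕ; zero; suc; z≤n; s≤s)
open import Data.Nat.Divisibility using (divides-refl)
open import Data.Nat.DivMod as ℕ using (_mod_)
open import Data.Product.Base using (∃-syntax; _×_; _,_; proj₁; proj₂; uncurry)
open import Data.Sum.Base using (_⊎_; inj₁; inj₂; [_,_]′; map₂)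
open import Data.Vec.Base using (lookup; _[_]≔_)
open import Data.Vec.Functional using (Vector; removeAt; updateAt; transpose)
open import Data.Vec.Functional.Properties using (updateAt-updates; updateAt-minimal)
open import Data.Vec.Properties using (lookup-replicate; lookup∘update; lookup∘update′; []≔-commutes)
open import Function.Base using (_∘_; const; id)
open import Level using (0ℓ)
open import Relation.Binary.Bundles using (StrictPartialOrder)
open import Relation.Binary.Construct.Add.Supremum.NonStrict using ([_]; _≤⊤⁺)
open import Relation.Binary.Definitions using (_Respects_; tri<; tri≈; tri>)
open import Relation.Binary.PropositionalEquality.Core as ≡ using (_≡_; _≢_)
open import Relation.Binary.Structures using (IsStrictTotalOrder)
open import Relation.Nullary using (¬_; yes; no)
open import Relation.Nullary.Construct.Add.Supremum using (⊤⁺; [_])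
open import Relation.Unary using (_∈_; _∉_)
open import Defs
import Algebra.Properties.CommutativeMonoid.Sum as MonoidSum
import Algebra.Properties.Ring as RingProperties
import Algebra.Properties.Semiring.Mult as Mult
import Algebra.Properties.Semiring.Sum as SemiringSum
import Algebra.Solver.Ring as RingSolver
import Data.Integer.Properties as ℤ
import Data.Nat.Properties as ℕ
import Relation.Binary.Construct.StrictToNonStrict as StrictToNonStrict
import Relation.Binary.Reasoning.Setoid as SetoidReasoning
import Relation.Binary.Reasoning.StrictPartialOrder as StrictReasoning

-- A ring solver with integer coefficients.

module IntegerSolver (R : CommutativeRing 0ℓ 0ℓ) where

  open CommutativeRing R hiding (zero)
  open RingProperties ring
  open Mult semiring renaming (_×_ to _·_)
  open SetoidReasoning setoid

  ⟦_⟧ : ℤ → Carrier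
  ⟦ ℤ.+ n ⟧     = n · 1#
  ⟦ -[1+ n ] ⟧ = - (suc n · 1#)

  neg-homo : ∀ i → ⟦ ℤ.- i ⟧ ≈ - ⟦ i ⟧
  neg-homo (ℤ.+ zero)  = sym -0#≈0#
  neg-homo (ℤ.+ suc n) = refl
  neg-homo -[1+ n ]    = sym (-‿involutive _)

  -- Each step of the recursion cancels one `1#` on both sides. Sums of integers of opposite sign
  -- reduce to this case.
  ⊖-homo : ∀ m n → ⟦ m ⊖ n ⟧ ≈ m · 1# - n · 1#
  ⊖-homo zero    n = trans (reflexive (≡.cong ⟦_⟧ (ℤ.⊖-≤ {zero} {n} ℕ.z≤n)))
    (trans (neg-homo (ℤ.+ n)) (sym (+-identityˡ _)))
  ⊖-homo (suc m) zero = sym (trans (+-congˡ -0#≈0#) (+-identityʳ _))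
  ⊖-homo (suc m) (suc n) = begin
    ⟦ suc m ⊖ suc n ⟧                     ≡⟨ ≡.cong ⟦_⟧ (ℤ.[1+m]⊖[1+n]≡m⊖n m n) ⟩
    ⟦ m ⊖ n ⟧                             ≈⟨ ⊖-homo m n ⟩
    m · 1# - n · 1#                       ≈⟨ +-congˡ (+-identityˡ _) ⟨
    m · 1# + (0# - n · 1#)                ≈⟨ +-congˡ (+-congʳ (-‿inverseʳ 1#)) ⟨
    m · 1# + (1# - 1# - n · 1#)           ≈⟨ +-congˡ (+-assoc _ _ _) ⟩
    m · 1# + (1# + (- 1# - n · 1#))       ≈⟨ +-assoc _ _ _ ⟨
    m · 1# + 1# + (- 1# - n · 1#)         ≈⟨ +-cong (+-comm _ _) (-‿+-comm _ _) ⟩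
    suc m · 1# - suc n · 1#               ∎

  +-homo : ∀ i j → ⟦ i ℤ.+ j ⟧ ≈ ⟦ i ⟧ + ⟦ j ⟧
  +-homo (ℤ.+ m)  (ℤ.+ n)  = ×-homo-+ 1# m n
  +-homo (ℤ.+ m)  -[1+ n ] = ⊖-homo m (suc n)
  +-homo -[1+ m ] (ℤ.+ n)  = trans (⊖-homo n (suc m)) (+-comm _ _)
  +-homo -[1+ m ] -[1+ n ] = begin
    - (suc (suc (m ℕ.+ n)) · 1#)          ≈⟨ -‿cong (+-congˡ (×-homo-+ 1# (suc m) n)) ⟩
    - (1# + (suc m · 1# + n · 1#))        ≈⟨ -‿cong (+-assoc _ _ _) ⟨
    - (1# + suc m · 1# + n · 1#)          ≈⟨ -‿cong (+-congʳ (+-comm _ _)) ⟩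
    - (suc m · 1# + 1# + n · 1#)          ≈⟨ -‿cong (+-assoc _ _ _) ⟩
    - (suc m · 1# + suc n · 1#)           ≈⟨ -‿+-comm _ _ ⟨
    - (suc m · 1#) - suc n · 1#           ∎

  *-homo-+ : ∀ m j → ⟦ ℤ.+ m ℤ.* j ⟧ ≈ m · 1# * ⟦ j ⟧
  *-homo-+ m (ℤ.+ n)  = trans (reflexive (≡.cong ⟦_⟧ (≡.sym (ℤ.pos-* m n)))) (×1-homo-* m n)
  *-homo-+ m -[1+ n ] = begin
    ⟦ ℤ.+ m ℤ.* -[1+ n ] ⟧                ≡⟨ ≡.cong ⟦_⟧ (ℤ.neg-distribʳ-* (ℤ.+ m) (ℤ.+ suc n)) ⟨
    ⟦ ℤ.- (ℤ.+ m ℤ.* ℤ.+ suc n) ⟧         ≈⟨ neg-homo (ℤ.+ m ℤ.* ℤ.+ suc n) ⟩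
    - ⟦ ℤ.+ m ℤ.* ℤ.+ suc n ⟧             ≡⟨ ≡.cong (λ i → - ⟦ i ⟧) (ℤ.pos-* m (suc n)) ⟨
    - ((m ℕ.* suc n) · 1#)                ≈⟨ -‿cong (×1-homo-* m (suc n)) ⟩
    - (m · 1# * suc n · 1#)               ≈⟨ -‿distribʳ-* _ _ ⟩
    m · 1# * ⟦ -[1+ n ] ⟧                 ∎

  *-homo : ∀ i j → ⟦ i ℤ.* j ⟧ ≈ ⟦ i ⟧ * ⟦ j ⟧
  *-homo (ℤ.+ m)  j = *-homo-+ m j
  *-homo -[1+ m ] j = begin
    ⟦ -[1+ m ] ℤ.* j ⟧                    ≡⟨ ≡.cong ⟦_⟧ (ℤ.neg-distribˡ-* (ℤ.+ suc m) j) ⟨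
    ⟦ ℤ.- (ℤ.+ suc m ℤ.* j) ⟧             ≈⟨ neg-homo (ℤ.+ suc m ℤ.* j) ⟩
    - ⟦ ℤ.+ suc m ℤ.* j ⟧                 ≈⟨ -‿cong (*-homo-+ (suc m) j) ⟩
    - (suc m · 1# * ⟦ j ⟧)                ≈⟨ -‿distribˡ-* _ _ ⟩
    ⟦ -[1+ m ] ⟧ * ⟦ j ⟧                  ∎

  morphism : ℤ.+-*-rawRing -Raw-AlmostCommutative⟶ fromCommutativeRing R
  morphism = record
    { ⟦_⟧    = ⟦_⟧
    ; +-homo = +-homo
    ; *-homo = *-homo
    ; -‿homo = neg-homo
    ; 0-homo = refl
    ; 1-homo = +-identityʳ 1#
    }

  -- Coefficients are compared in `ℤ`, where equality is decidable. Distinct integers may still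
  -- agree in the ring, hence `nothing` instead of a refutation.
  coeff≟ : ∀ i j → Maybe (⟦ i ⟧ ≈ ⟦ j ⟧)
  coeff≟ i j with i ℤ.≟ j
  ... | yes i≡j = just (reflexive (≡.cong ⟦_⟧ i≡j))
  ... | no  _   = nothing

  open RingSolver ℤ.+-*-rawRing (fromCommutativeRing R) morphism coeff≟ public
    using (solve; con; _:=_; _:+_; _:*_; _:-_; :-_)

-- Arithmetic, finite sums and products, and absolute values in a complete ordered field.

module OrderedField (R : CompleteOrderedField) where

  open Euclidean R
  open IsStrictTotalOrder isStrictTotalOrder public
    using (compare; irrefl; <-resp-≈; <-respʳ-≈; <-respˡ-≈; isStrictPartialOrder)
    renaming (trans to <-trans)
  open RingProperties ring public using (-‿involutive; -0#≈0#; -‿distribˡ-*)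
  open Mult semiring public using (×-congʳ; ×-comm-*) renaming (_×_ to _·_)
  open IntegerSolver commutativeRing public
  open SemiringSum semiring public
    using (sum-cong-≋; sum-remove; ∑-distrib-+; *-distribˡ-sum; sum-replicate-zero)
  open MonoidSum *-commutativeMonoid public
    using () renaming (sum-cong-≋ to product-cong; sum-remove to product-remove)
  private module NonStrict = StrictToNonStrict _≈_ _<_

  strictPartialOrder : StrictPartialOrder 0ℓ 0ℓ 0ℓ
  strictPartialOrder = record { isStrictPartialOrder = isStrictPartialOrder }

  module ≤-Reasoning = StrictReasoning strictPartialOrder
  open ≤-Reasoning

  ≤-refl : ∀ {x} → x ≤ x
  ≤-refl = inj₂ refl

  ≤-trans : ∀ {x y z} → x ≤ y → y ≤ z → x ≤ z
  ≤-trans = NonStrict.trans isEquivalence <-resp-≈ <-trans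

  <-≤-trans : ∀ {x y z} → x < y → y ≤ z → x < z
  <-≤-trans = NonStrict.<-≤-trans <-trans <-respʳ-≈

  ≤-<-trans : ∀ {x y z} → x ≤ y → y < z → x < z
  ≤-<-trans = NonStrict.≤-<-trans sym <-trans <-respˡ-≈

  ≤-total : ∀ x y → x ≤ y ⊎ y ≤ x
  ≤-total = NonStrict.total compare

  <-or-≥ : ∀ x y → x < y ⊎ y ≤ x
  <-or-≥ x y with compare x y
  ... | tri< x<y _ _ = inj₁ x<y
  ... | tri≈ _ x≈y _ = inj₂ (inj₂ (sym x≈y))
  ... | tri> _ _ y<x = inj₂ (inj₁ y<x)

  ≤⇒≯ : ∀ {x y} → x ≤ y → ¬ (y < x)
  ≤⇒≯ x≤y y<x = irrefl refl (≤-<-trans x≤y y<x)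

  ≤-antisym : ∀ {x y} → x ≤ y → y ≤ x → x ≈ y
  ≤-antisym (inj₂ x≈y) _   = x≈y
  ≤-antisym (inj₁ x<y) y≤x = ⊥-elim (≤⇒≯ y≤x x<y)

  ≮⇒≥ : ∀ {x y} → ¬ (x < y) → y ≤ x
  ≮⇒≥ {x} {y} x≮y = [ (λ x<y → ⊥-elim (x≮y x<y)) , (λ y≤x → y≤x) ]′ (<-or-≥ x y)

  ≰⇒> : ∀ {x y} → ¬ (x ≤ y) → y < x
  ≰⇒> {x} {y} x≰y = [ (λ y<x → y<x) , (λ x≤y → ⊥-elim (x≰y x≤y)) ]′ (<-or-≥ y x)

  0<y-x : ∀ {x y} → x < y → 0# < y - x
  0<y-x {x} {y} x<y = begin-strict
    0#     ≈⟨ -‿inverseʳ x ⟨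
    x - x  <⟨ +-monoˡ-< (- x) x<y ⟩
    y - x  ∎

  0≤y-x : ∀ {x y} → x ≤ y → 0# ≤ y - x
  0≤y-x (inj₁ x<y) = inj₁ (0<y-x x<y)
  0≤y-x {x} (inj₂ x≈y) = inj₂ (trans (sym (-‿inverseʳ x)) (+-congʳ x≈y))

  -- The next two lemmas reduce linear inequalities to ring identities.
  <-from-gap : ∀ {x y d} → 0# < d → y ≈ x + d → x < y
  <-from-gap {x} {y} {d} 0<d y≈x+d = begin-strict
    x       ≈⟨ +-identityˡ x ⟨
    0# + x  <⟨ +-monoˡ-< x 0<d ⟩
    d + x   ≈⟨ +-comm d x ⟩
    x + d   ≈⟨ y≈x+d ⟨
    y       ∎

  ≤-from-gap : ∀ {x y d} → 0# ≤ d → y ≈ x + d → x ≤ y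
  ≤-from-gap (inj₁ 0<d) y≈x+d = inj₁ (<-from-gap 0<d y≈x+d)
  ≤-from-gap {x} (inj₂ 0≈d) y≈x+d =
    inj₂ (trans (sym (+-identityʳ x)) (trans (+-congˡ 0≈d) (sym y≈x+d)))

  +-monoˡ-≤ : ∀ z {x y} → x ≤ y → x + z ≤ y + z
  +-monoˡ-≤ z (inj₁ x<y) = inj₁ (+-monoˡ-< z x<y)
  +-monoˡ-≤ z (inj₂ x≈y) = inj₂ (+-congʳ x≈y)

  +-monoʳ-≤ : ∀ z {x y} → x ≤ y → z + x ≤ z + y
  +-monoʳ-≤ z {x} {y} x≤y = begin
    z + x  ≈⟨ +-comm z x ⟩
    x + z  ≤⟨ +-monoˡ-≤ z x≤y ⟩
    y + z  ≈⟨ +-comm y z ⟩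
    z + y  ∎

  +-mono-≤ : ∀ {w x y z} → w ≤ x → y ≤ z → w + y ≤ x + z
  +-mono-≤ {x = x} {y} w≤x y≤z = ≤-trans (+-monoˡ-≤ y w≤x) (+-monoʳ-≤ x y≤z)

  +-mono-<-≤ : ∀ {w x y z} → w < x → y ≤ z → w + y < x + z
  +-mono-<-≤ {x = x} {y} w<x y≤z = <-≤-trans (+-monoˡ-< y w<x) (+-monoʳ-≤ x y≤z)

  0≤x+y : ∀ {x y} → 0# ≤ x → 0# ≤ y → 0# ≤ x + y
  0≤x+y 0≤x 0≤y = ≤-trans (inj₂ (sym (+-identityˡ 0#))) (+-mono-≤ 0≤x 0≤y)

  x≤x+y : ∀ {x y} → 0# ≤ y → x ≤ x + y
  x≤x+y 0≤y = ≤-from-gap 0≤y refl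

  y≤x+y : ∀ {x y} → 0# ≤ x → y ≤ x + y
  y≤x+y {x} {y} 0≤x = ≤-from-gap 0≤x (+-comm x y)

  neg-mono-≤ : ∀ {x y} → x ≤ y → - y ≤ - x
  neg-mono-≤ {x} {y} x≤y =
    ≤-from-gap (0≤y-x x≤y) (solve 2 (λ x y → :- x := :- y :+ (y :- x)) refl x y)

  neg-nonneg : ∀ {x} → x ≤ 0# → 0# ≤ - x
  neg-nonneg x≤0 = ≤-trans (inj₂ (sym -0#≈0#)) (neg-mono-≤ x≤0)

  0≤x*y : ∀ {x y} → 0# ≤ x → 0# ≤ y → 0# ≤ x * y
  0≤x*y (inj₁ 0<x) (inj₁ 0<y) = inj₁ (*-pos 0<x 0<y)
  0≤x*y {x} (inj₁ 0<x) (inj₂ 0≈y) = inj₂ (trans (sym (zeroʳ x)) (*-congˡ 0≈y))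
  0≤x*y {y = y} (inj₂ 0≈x) _      = inj₂ (trans (sym (zeroˡ y)) (*-congʳ 0≈x))

  *-monoˡ-≤ : ∀ {x y z} → 0# ≤ z → x ≤ y → z * x ≤ z * y
  *-monoˡ-≤ {x} {y} {z} 0≤z x≤y = ≤-from-gap (0≤x*y 0≤z (0≤y-x x≤y))
    (solve 3 (λ x y z → z :* y := z :* x :+ z :* (y :- x)) refl x y z)

  *-monoʳ-≤ : ∀ {x y z} → 0# ≤ z → x ≤ y → x * z ≤ y * z
  *-monoʳ-≤ {x} {y} {z} 0≤z x≤y = begin
    x * z  ≈⟨ *-comm x z ⟩
    z * x  ≤⟨ *-monoˡ-≤ 0≤z x≤y ⟩
    z * y  ≈⟨ *-comm z y ⟩
    y * z  ∎

  *-mono-≤ : ∀ {w x y z} → 0# ≤ w → 0# ≤ y → w ≤ x → y ≤ z → w * y ≤ x * z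
  *-mono-≤ 0≤w 0≤y w≤x y≤z = ≤-trans (*-monoʳ-≤ 0≤y w≤x) (*-monoˡ-≤ (≤-trans 0≤w w≤x) y≤z)

  0≤x*x : ∀ x → 0# ≤ x * x
  0≤x*x x with ≤-total 0# x
  ... | inj₁ 0≤x = 0≤x*y 0≤x 0≤x
  ... | inj₂ x≤0 = ≤-trans (0≤x*y (neg-nonneg x≤0) (neg-nonneg x≤0))
                     (inj₂ (solve 1 (λ x → :- x :* :- x := x :* x) refl x))

  0<1 : 0# < 1#
  0<1 with 0≤x*x 1#
  ... | inj₁ 0<1*1 = <-respʳ-≈ (*-identityˡ 1#) 0<1*1
  ... | inj₂ 0≈1*1 = ⊥-elim (0≉1 (trans 0≈1*1 (*-identityˡ 1#)))

  0<x+y : ∀ {x y} → 0# < x → 0# ≤ y → 0# < x + y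
  0<x+y 0<x 0≤y = <-≤-trans 0<x (x≤x+y 0≤y)

  *-cancel-0< : ∀ {x y} → 0# < x * y → 0# ≤ y → 0# < x
  *-cancel-0< {x} {y} 0<xy 0≤y = ≰⇒> λ x≤0 → ≤⇒≯
    (begin
      x * y   ≤⟨ *-monoʳ-≤ 0≤y x≤0 ⟩
      0# * y  ≈⟨ zeroˡ y ⟩
      0#      ∎)
    0<xy

  positive-inverse : ∀ {x} → 0# < x → ∃[ y ] 0# < y × x * y ≈ 1#
  positive-inverse {x} 0<x with inverse x (λ x≈0 → irrefl (sym x≈0) 0<x)
  ... | y , xy≈1 = y , *-cancel-0< (<-respʳ-≈ (trans (sym xy≈1) (*-comm x y)) 0<1) (inj₁ 0<x) , xy≈1

  -- The witness is δ/(1+y): the summand 1 makes the divisor positive even for y = 0, and leaves the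
  -- gap δ/(1+y) that makes the inequality strict.
  small-factor : ∀ {y δ} → 0# ≤ y → 0# < δ → ∃[ x ] 0# < x × x * y < δ
  small-factor {y} {δ} 0≤y 0<δ with positive-inverse (0<x+y 0<1 0≤y)
  ... | z , 0<z , [1+y]z≈1 = δ * z , *-pos 0<δ 0<z , <-from-gap (*-pos 0<δ 0<z) (begin-equality
    δ                      ≈⟨ *-identityʳ δ ⟨
    δ * 1#                 ≈⟨ *-congˡ [1+y]z≈1 ⟨
    δ * ((1# + y) * z)     ≈⟨ *-congˡ (distribʳ z 1# y) ⟩
    δ * (1# * z + y * z)   ≈⟨ *-congˡ (+-congʳ (*-identityˡ z)) ⟩
    δ * (z + y * z)        ≈⟨ solve 3 (λ y z δ → δ :* (z :+ y :* z) := δ :* z :* y :+ δ :* z)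
                                refl y z δ ⟩
    δ * z * y + δ * z      ∎)

  half : ∀ x → 0# < x → ∃[ h ] 0# < h × h + h ≈ x
  half x 0<x with positive-inverse (0<x+y 0<1 (inj₁ 0<1))
  ... | z , 0<z , 2z≈1 = x * z , *-pos 0<x 0<z , (begin-equality
    x * z + x * z                ≈⟨ distribˡ x z z ⟨
    x * (z + z)                  ≈⟨ *-congˡ (+-cong (*-identityˡ z) (*-identityˡ z)) ⟨
    x * (1# * z + 1# * z)        ≈⟨ *-congˡ (distribʳ z 1# 1#) ⟨
    x * ((1# + 1#) * z)          ≈⟨ *-congˡ 2z≈1 ⟩
    x * 1#                       ≈⟨ *-identityʳ x ⟩
    x                            ∎)

  square-cancel-< : ∀ {x r} → 0# < r → x * x < r * r → x < r
  square-cancel-< 0<r x²<r² = ≰⇒> λ r≤x → ≤⇒≯ (*-mono-≤ (inj₁ 0<r) (inj₁ 0<r) r≤x r≤x) x²<r²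

  0≤n·x : ∀ n {x} → 0# ≤ x → 0# ≤ n · x
  0≤n·x zero    0≤x = ≤-refl
  0≤n·x (suc n) 0≤x = 0≤x+y 0≤x (0≤n·x n 0≤x)

  -- If all multiples of `s` were at most `x`, their supremum `σ` would satisfy `σ ≤ σ - s`, because
  -- `suc n · s` is a multiple whenever `n · s` is.
  archimedean : ExcludedMiddle 0ℓ → ∀ {s} → 0# < s → ∀ x → ∃[ n ] x < n · s
  archimedean em {s} 0<s x with em {∃[ n ] x < n · s}
  ... | yes unbounded = unbounded
  ... | no  bounded   = ⊥-elim (≤⇒≯ σ≤σ-s (<-from-gap 0<s
    (solve 2 (λ σ s → σ := σ :- s :+ s) refl σ s)))
    where
    multiples : ℝ → Set
    multiples y = ∃[ n ] y ≈ n · s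
    supremum = complete multiples (0# , zero , refl)
      (x , λ { y (n , y≈ns) → ≤-trans (inj₂ y≈ns) (≮⇒≥ (λ x<ns → bounded (n , x<ns))) })
    σ = proj₁ supremum
    σ≤σ-s : σ ≤ σ - s
    σ≤σ-s = proj₂ (proj₂ supremum) (σ - s) λ { y (n , y≈ns) → ≤-trans (inj₂ y≈ns)
      (≤-from-gap (0≤y-x (proj₁ (proj₂ supremum) (suc n · s) (suc n , refl)))
        (solve 3 (λ σ s t → σ :- s := t :+ (σ :- (s :+ t))) refl σ s (n · s))) }

  -- Doubling is written as an addition, so that the width of the interval from `2^ j` to
  -- `2^ (suc j)` is `2^ j` by a mere ring identity.
  2^ : ℕ → ℝ
  2^ zero    = 1#
  2^ (suc j) = 2^ j + 2^ j

  2^-pos : ∀ j → 0# < 2^ j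
  2^-pos zero    = 0<1
  2^-pos (suc j) = 0<x+y (2^-pos j) (inj₁ (2^-pos j))

  2^-step : ∀ j → 2^ j ≤ 2^ (suc j)
  2^-step j = x≤x+y (inj₁ (2^-pos j))

  2^-mono : ∀ j d → 2^ j ≤ 2^ (d ℕ.+ j)
  2^-mono j zero    = ≤-refl
  2^-mono j (suc d) = ≤-trans (2^-mono j d) (2^-step (d ℕ.+ j))

  1≤2^ : ∀ j → 1# ≤ 2^ j
  1≤2^ j = ≤-trans (2^-mono 0 j) (inj₂ (reflexive (≡.cong 2^ (ℕ.+-identityʳ j))))

  n≤2^n : ∀ j → j · 1# ≤ 2^ j
  n≤2^n zero    = inj₁ 0<1
  n≤2^n (suc j) = +-mono-≤ (1≤2^ j) (n≤2^n j)

  infixl 6 _⊓_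
  _⊓_ : ℝ → ℝ → ℝ
  x ⊓ y = [ (λ _ → x) , (λ _ → y) ]′ (≤-total x y)

  x⊓y≤x : ∀ x y → x ⊓ y ≤ x
  x⊓y≤x x y with ≤-total x y
  ... | inj₁ _   = ≤-refl
  ... | inj₂ y≤x = y≤x

  x⊓y≤y : ∀ x y → x ⊓ y ≤ y
  x⊓y≤y x y with ≤-total x y
  ... | inj₁ x≤y = x≤y
  ... | inj₂ _   = ≤-refl

  ⊓-pos : ∀ {x y} → 0# < x → 0# < y → 0# < x ⊓ y
  ⊓-pos {x} {y} 0<x 0<y with ≤-total x y
  ... | inj₁ _ = 0<x
  ... | inj₂ _ = 0<y

  -- This gives a common radius for finitely many balls; the empty family gets the default `1#`.
  positive-minorant : ∀ {n} (f : Fin n → ℝ) → (∀ i → 0# < f i) →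
                      ∃[ r ] 0# < r × (∀ i → r ≤ f i)
  positive-minorant {zero}  f 0<f = 1# , 0<1 , λ ()
  positive-minorant {suc n} f 0<f with positive-minorant (f ∘ suc) (0<f ∘ suc)
  ... | r , 0<r , r≤f = f zero ⊓ r , ⊓-pos (0<f zero) 0<r ,
    λ { zero → x⊓y≤x (f zero) r ; (suc i) → ≤-trans (x⊓y≤y (f zero) r) (r≤f i) }

  sum-mono : ∀ {n} {f g : Vector ℝ n} → (∀ i → f i ≤ g i) → sum f ≤ sum g
  sum-mono {zero}  f≤g = ≤-refl
  sum-mono {suc n} f≤g = +-mono-≤ (f≤g zero) (sum-mono (f≤g ∘ suc))

  sum-nonneg : ∀ {n} {f : Vector ℝ n} → (∀ i → 0# ≤ f i) → 0# ≤ sum f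
  sum-nonneg {zero}  0≤f = ≤-refl
  sum-nonneg {suc n} 0≤f = 0≤x+y (0≤f zero) (sum-nonneg (0≤f ∘ suc))

  term≤sum : ∀ {n} {f : Vector ℝ n} → (∀ i → 0# ≤ f i) → ∀ i → f i ≤ sum f
  term≤sum {suc n} 0≤f zero    = x≤x+y (sum-nonneg (0≤f ∘ suc))
  term≤sum {suc n} 0≤f (suc i) = ≤-trans (term≤sum (0≤f ∘ suc) i) (y≤x+y (0≤f zero))

  product-nonneg : ∀ {n} {f : Vector ℝ n} → (∀ i → 0# ≤ f i) → 0# ≤ product f
  product-nonneg {zero}  0≤f = inj₁ 0<1
  product-nonneg {suc n} 0≤f = 0≤x*y (0≤f zero) (product-nonneg (0≤f ∘ suc))

  product-mono : ∀ {n} {f g : Vector ℝ n} → (∀ i → 0# ≤ f i) → (∀ i → f i ≤ g i) →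
                 product f ≤ product g
  product-mono {zero}  0≤f f≤g = ≤-refl
  product-mono {suc n} 0≤f f≤g =
    *-mono-≤ (0≤f zero) (product-nonneg (0≤f ∘ suc)) (f≤g zero)
      (product-mono (0≤f ∘ suc) (f≤g ∘ suc))

  product-zero : ∀ {n} (f : Vector ℝ n) i → f i ≈ 0# → product f ≈ 0#
  product-zero {suc n} f i fi≈0 = begin-equality
    product f                     ≈⟨ product-remove {i = i} f ⟩
    f i * product (removeAt f i)  ≈⟨ *-congʳ fi≈0 ⟩
    0# * product (removeAt f i)   ≈⟨ zeroˡ _ ⟩
    0#                            ∎

  product-one : ∀ n → product {n} (λ _ → 1#) ≈ 1#
  product-one zero    = refl
  product-one (suc n) = trans (*-identityˡ _) (product-one n)

  partialSum : (ℕ → ℝ) → ℕ → ℝ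
  partialSum f m = sum {m} (f ∘ toℕ)

  partialSum-mono-≤ : ∀ {f} → (∀ k → 0# ≤ f k) → ∀ m d → partialSum f m ≤ partialSum f (m ℕ.+ d)
  partialSum-mono-≤ 0≤f zero    d = sum-nonneg {d} (0≤f ∘ toℕ)
  partialSum-mono-≤ {f} 0≤f (suc m) d = +-monoʳ-≤ (f 0) (partialSum-mono-≤ (0≤f ∘ suc) m d)

  term≤partialSum : ∀ {f} → (∀ k → 0# ≤ f k) → ∀ m → f m ≤ partialSum f (suc m)
  term≤partialSum 0≤f zero    = x≤x+y ≤-refl
  term≤partialSum 0≤f (suc m) = ≤-trans (term≤partialSum (0≤f ∘ suc) m) (y≤x+y (0≤f 0))

  x≤∣x∣ : ∀ x → x ≤ ∣ x ∣
  x≤∣x∣ x with x <? 0#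
  ... | yes x<0 = inj₁ (<-≤-trans x<0 (neg-nonneg (inj₁ x<0)))
  ... | no  _   = ≤-refl

  -x≤∣x∣ : ∀ x → - x ≤ ∣ x ∣
  -x≤∣x∣ x with x <? 0#
  ... | yes _   = ≤-refl
  ... | no  x≮0 = ≤-trans (neg-mono-≤ (≮⇒≥ x≮0)) (≤-trans (inj₂ -0#≈0#) (≮⇒≥ x≮0))

  ∣∣-least : ∀ {x b} → x ≤ b → - x ≤ b → ∣ x ∣ ≤ b
  ∣∣-least {x} x≤b -x≤b with x <? 0#
  ... | yes _ = -x≤b
  ... | no  _ = x≤b

  0≤∣x∣ : ∀ x → 0# ≤ ∣ x ∣
  0≤∣x∣ x with x <? 0#
  ... | yes x<0 = neg-nonneg (inj₁ x<0)
  ... | no  x≮0 = ≮⇒≥ x≮0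

  -- The sign test inside `∣_∣` does not compute alike for `x` and `y`, so the comparison goes
  -- through `∣∣-least`.
  ∣∣-cong : ∀ {x y} → x ≈ y → ∣ x ∣ ≤ ∣ y ∣
  ∣∣-cong {x} {y} x≈y = ∣∣-least (≤-trans (inj₂ x≈y) (x≤∣x∣ y))
    (≤-trans (inj₂ (-‿cong x≈y)) (-x≤∣x∣ y))

  ∣x+y∣≤∣x∣+∣y∣ : ∀ x y → ∣ x + y ∣ ≤ ∣ x ∣ + ∣ y ∣
  ∣x+y∣≤∣x∣+∣y∣ x y = ∣∣-least (+-mono-≤ (x≤∣x∣ x) (x≤∣x∣ y))
    (≤-trans (inj₂ (solve 2 (λ x y → :- (x :+ y) := :- x :+ :- y) refl x y))
      (+-mono-≤ (-x≤∣x∣ x) (-x≤∣x∣ y)))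

  ∣-x∣≤∣x∣ : ∀ x → ∣ - x ∣ ≤ ∣ x ∣
  ∣-x∣≤∣x∣ x = ∣∣-least (-x≤∣x∣ x) (≤-trans (inj₂ (-‿involutive x)) (x≤∣x∣ x))

  ∣x*y∣≤∣x∣*∣y∣ : ∀ x y → ∣ x * y ∣ ≤ ∣ x ∣ * ∣ y ∣
  ∣x*y∣≤∣x∣*∣y∣ x y = by-sign x (≤-total 0# x)
    where
    multiple : ∀ {z} → 0# ≤ z → ∣ z * y ∣ ≤ z * ∣ y ∣
    multiple {z} 0≤z = ∣∣-least (*-monoˡ-≤ 0≤z (x≤∣x∣ y))
      (≤-trans (inj₂ (solve 2 (λ z y → :- (z :* y) := z :* :- y) refl z y))
        (*-monoˡ-≤ 0≤z (-x≤∣x∣ y)))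
    by-sign : ∀ x → 0# ≤ x ⊎ x ≤ 0# → ∣ x * y ∣ ≤ ∣ x ∣ * ∣ y ∣
    by-sign x (inj₁ 0≤x) = ≤-trans (multiple 0≤x) (*-monoʳ-≤ (0≤∣x∣ y) (x≤∣x∣ x))
    by-sign x (inj₂ x≤0) = begin
      ∣ x * y ∣         ≤⟨ ∣∣-cong (solve 2 (λ x y → x :* y := :- (:- x :* y)) refl x y) ⟩
      ∣ - (- x * y) ∣   ≤⟨ ∣-x∣≤∣x∣ _ ⟩
      ∣ - x * y ∣       ≤⟨ multiple (neg-nonneg x≤0) ⟩
      - x * ∣ y ∣       ≤⟨ *-monoʳ-≤ (0≤∣x∣ y) (-x≤∣x∣ x) ⟩
      ∣ x ∣ * ∣ y ∣     ∎

  ∣sum∣≤ : ∀ {n} (f : Vector ℝ n) {b} → (∀ i → ∣ f i ∣ ≤ b) → ∣ sum f ∣ ≤ n · b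
  ∣sum∣≤ {zero}  f ∣f∣≤b = ∣∣-least ≤-refl (inj₂ -0#≈0#)
  ∣sum∣≤ {suc n} f ∣f∣≤b =
    ≤-trans (∣x+y∣≤∣x∣+∣y∣ (f zero) _) (+-mono-≤ (∣f∣≤b zero) (∣sum∣≤ (f ∘ suc) (∣f∣≤b ∘ suc)))

-- Deficient boxes contain uncovered points.

module BoxCovers (em : ExcludedMiddle 0ℓ) (R : CompleteOrderedField) where

  open Euclidean R
  open OrderedField R
  open ≤-Reasoning

  open Box using (lower; upper; lower≤upper)

  -- For `l ≤ u` this is the monotone retraction of the line onto [l,u]. The difference of the
  -- clamped ends of an interval is therefore the length of its intersection with [l,u].
  clamp : ℝ → ℝ → ℝ → ℝ
  clamp l u x = [ const l , const ([ const x , const u ]′ (≤-total x u)) ]′ (≤-total x l)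

  clamp-lower : ∀ {l u} → l ≤ u → ∀ x → l ≤ clamp l u x
  clamp-lower {l} {u} l≤u x with ≤-total x l | ≤-total x u
  ... | inj₁ _   | _      = ≤-refl
  ... | inj₂ l≤x | inj₁ _ = l≤x
  ... | inj₂ _   | inj₂ _ = l≤u

  clamp-upper : ∀ {l u} → l ≤ u → ∀ x → clamp l u x ≤ u
  clamp-upper {l} {u} l≤u x with ≤-total x l | ≤-total x u
  ... | inj₁ _ | _        = l≤u
  ... | inj₂ _ | inj₁ x≤u = x≤u
  ... | inj₂ _ | inj₂ _   = ≤-refl

  clamp-mono : ∀ {l u} → l ≤ u → ∀ {x y} → x ≤ y → clamp l u x ≤ clamp l u y
  clamp-mono {l} {u} l≤u {x} {y} x≤y with ≤-total x l | ≤-total y l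
  ... | inj₁ _   | inj₁ _   = ≤-refl
  ... | inj₂ l≤x | inj₁ y≤l with ≤-total x u
  ...   | inj₁ _   = ≤-trans x≤y y≤l
  ...   | inj₂ u≤x = ≤-trans u≤x (≤-trans x≤y y≤l)
  clamp-mono {l} {u} l≤u {x} {y} x≤y | inj₁ _ | inj₂ l≤y with ≤-total y u
  ...   | inj₁ _ = l≤y
  ...   | inj₂ _ = l≤u
  clamp-mono {l} {u} l≤u {x} {y} x≤y | inj₂ _ | inj₂ _ with ≤-total x u | ≤-total y u
  ...   | inj₁ _   | inj₁ _   = x≤y
  ...   | inj₁ x≤u | inj₂ _   = x≤u
  ...   | inj₂ u≤x | inj₁ _   = ≤-trans u≤x x≤y
  ...   | inj₂ _   | inj₂ _   = ≤-refl

  clamp-inside : ∀ {l u x} → l ≤ x → x ≤ u → clamp l u x ≈ x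
  clamp-inside {l} {u} {x} l≤x x≤u with ≤-total x l | ≤-total x u
  ... | inj₁ x≤l | _        = ≤-antisym l≤x x≤l
  ... | inj₂ _   | inj₁ _   = refl
  ... | inj₂ _   | inj₂ u≤x = ≤-antisym u≤x x≤u

  product-remove-cong : ∀ {n} {e f : Vector ℝ (suc n)} i → (∀ k → k ≢ i → e k ≈ f k) →
                        product e ≈ e i * product (removeAt f i)
  product-remove-cong {e = e} i e≈f = trans (product-remove {i = i} e)
    (*-congˡ (product-cong (λ k → e≈f (punchIn i k) (punchInᵢ≢i i k))))

  product-split : ∀ {n} {f g h : Vector ℝ n} i → f i ≈ g i + h i →
                  (∀ k → k ≢ i → g k ≈ f k) → (∀ k → k ≢ i → h k ≈ f k) →
                  product f ≈ product g + product h
  product-split {suc n} {f} {g} {h} i fi g≈f h≈f = begin-equality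
    product f                  ≈⟨ product-remove {i = i} f ⟩
    f i * Π′                   ≈⟨ *-congʳ fi ⟩
    (g i + h i) * Π′           ≈⟨ distribʳ _ (g i) (h i) ⟩
    g i * Π′ + h i * Π′        ≈⟨ +-cong (product-remove-cong i g≈f) (product-remove-cong i h≈f) ⟨
    product g + product h      ∎
    where Π′ = product (removeAt f i)

  -- With `f` the side lengths of a box, `d` is the width of a slab of volume below `δ` that can be
  -- cut off in direction `i`. Its volume is `d` times the fixed product of the other sides, so
  -- `small-factor` applies; the minimum with `f i` keeps the slab inside the box.
  thin-slab : ∀ {n} {f : Vector ℝ n} i {δ} → (∀ k → 0# ≤ f k) → 0# < product f → 0# < δ →
              ∃[ d ] 0# < d × d ≤ f i ×
              (∀ {e} → e i ≈ d → (∀ k → k ≢ i → e k ≈ f k) → product e < δ)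
  thin-slab {suc n} {f} i {δ} 0≤f 0<Πf 0<δ = slab (small-factor 0≤Π′ 0<δ)
    where
    Π′ = product (removeAt f i)
    0≤Π′ : 0# ≤ Π′
    0≤Π′ = product-nonneg (λ k → 0≤f (punchIn i k))
    0<fi : 0# < f i
    0<fi = *-cancel-0< (<-respʳ-≈ (product-remove {i = i} f) 0<Πf) 0≤Π′
    slab : ∃[ x ] 0# < x × x * Π′ < δ → _
    slab (x , 0<x , xΠ′<δ) = x ⊓ f i , ⊓-pos 0<x 0<fi , x⊓y≤y x (f i) , λ {e} ei≈d e≈f → begin-strict
      product e         ≈⟨ product-remove-cong i e≈f ⟩
      e i * Π′          ≈⟨ *-congʳ ei≈d ⟩
      (x ⊓ f i) * Π′    ≤⟨ *-monoʳ-≤ 0≤Π′ (x⊓y≤x x (f i)) ⟩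
      x * Π′            <⟨ xΠ′<δ ⟩
      δ                 ∎

  -- The box function of a product of Stieltjes measures dφᵢ. The choice `const id` gives the volume
  -- and `clampTo B` the volume of the overlap with `B`, so one proof of additivity serves both.
  stieltjes : ∀ {n} → (Fin n → ℝ → ℝ) → Box n → ℝ
  stieltjes φ Q = product (λ i → φ i (upper Q i) - φ i (lower Q i))

  below : ∀ {n} (Q : Box n) i {c} → lower Q i ≤ c → Box n
  below Q i {c} l≤c = record
    { lower       = lower Q
    ; upper       = updateAt (upper Q) i (const c)
    ; lower≤upper = λ k → bounds k (k Fin.≟ i)
    }
    where
    bounds : ∀ k → _ → lower Q k ≤ updateAt (upper Q) i (const c) k
    bounds k (yes ≡.refl) = ≤-trans l≤c (inj₂ (reflexive (≡.sym (updateAt-updates i (upper Q)))))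
    bounds k (no k≢i)     = ≤-trans (lower≤upper Q k)
      (inj₂ (reflexive (≡.sym (updateAt-minimal k i (upper Q) k≢i))))

  above : ∀ {n} (Q : Box n) i {c} → c ≤ upper Q i → Box n
  above Q i {c} c≤u = record
    { lower       = updateAt (lower Q) i (const c)
    ; upper       = upper Q
    ; lower≤upper = λ k → bounds k (k Fin.≟ i)
    }
    where
    bounds : ∀ k → _ → updateAt (lower Q) i (const c) k ≤ upper Q k
    bounds k (yes ≡.refl) = ≤-trans (inj₂ (reflexive (updateAt-updates i (lower Q)))) c≤u
    bounds k (no k≢i)     = ≤-trans
      (inj₂ (reflexive (updateAt-minimal k i (lower Q) k≢i))) (lower≤upper Q k)

  module _ {n} (Q : Box n) (i : Fin n) {c : ℝ} (l≤c : lower Q i ≤ c) (c≤u : c ≤ upper Q i) where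

    -- In factor `i` the increments of `φ i` telescope at `c`; the other factors are common to all
    -- three boxes.
    stieltjes-additive : ∀ φ →
      stieltjes φ Q ≈ stieltjes φ (below Q i l≤c) + stieltjes φ (above Q i c≤u)
    stieltjes-additive φ = product-split i
      (begin-equality
        φ i (upper Q i) - φ i (lower Q i)
          ≈⟨ solve 3 (λ x y z → x :- z := (y :- z) :+ (x :- y)) refl _ (φ i c) _ ⟩
        φ i c - φ i (lower Q i) + (φ i (upper Q i) - φ i c)
          ≡⟨ ≡.cong₂ (λ y z → φ i y - φ i (lower Q i) + (φ i (upper Q i) - φ i z))
               (updateAt-updates i (upper Q)) (updateAt-updates i (lower Q)) ⟨
        _ ∎)
      (λ k k≢i → reflexive (≡.cong (λ y → φ k y - φ k (lower Q k))
        (updateAt-minimal k i (upper Q) k≢i)))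
      (λ k k≢i → reflexive (≡.cong (λ y → φ k (upper Q k) - φ k y)
        (updateAt-minimal k i (lower Q) k≢i)))

  infix 4 _⊑_
  _⊑_ : ∀ {n} → Box n → Box n → Set
  Q ⊑ Q′ = ∀ k → lower Q′ k ≤ lower Q k × upper Q k ≤ upper Q′ k

  ⊑-refl : ∀ {n} {Q : Box n} → Q ⊑ Q
  ⊑-refl k = ≤-refl , ≤-refl

  ⊑-trans : ∀ {n} {P Q S : Box n} → P ⊑ Q → Q ⊑ S → P ⊑ S
  ⊑-trans P⊑Q Q⊑S k = ≤-trans (proj₁ (Q⊑S k)) (proj₁ (P⊑Q k)) ,
                          ≤-trans (proj₂ (P⊑Q k)) (proj₂ (Q⊑S k))

  below-⊑ : ∀ {n} (Q : Box n) i {c} (l≤c : lower Q i ≤ c) → c ≤ upper Q i → below Q i l≤c ⊑ Q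
  below-⊑ Q i l≤c c≤u k with k Fin.≟ i
  ... | yes ≡.refl = ≤-refl , ≤-trans (inj₂ (reflexive (updateAt-updates i (upper Q)))) c≤u
  ... | no k≢i     = ≤-refl , inj₂ (reflexive (updateAt-minimal k i (upper Q) k≢i))

  above-⊑ : ∀ {n} (Q : Box n) i {c} (c≤u : c ≤ upper Q i) → lower Q i ≤ c → above Q i c≤u ⊑ Q
  above-⊑ Q i c≤u l≤c k with k Fin.≟ i
  ... | yes ≡.refl = ≤-trans l≤c (inj₂ (reflexive (≡.sym (updateAt-updates i (lower Q))))) , ≤-refl
  ... | no k≢i     = inj₂ (reflexive (≡.sym (updateAt-minimal k i (lower Q) k≢i))) , ≤-refl

  clampTo : ∀ {n} → Box n → Fin n → ℝ → ℝ
  clampTo B i = clamp (lower B i) (upper B i)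

  -- The volume of the intersection.  Written with clamped endpoints it is
  -- manifestly additive when Q is cut by a hyperplane.
  overlapVolume : ∀ {n} → Box n → Box n → ℝ
  overlapVolume B = stieltjes (clampTo B)

  overlapVolume-nonneg : ∀ {n} (B Q : Box n) → 0# ≤ overlapVolume B Q
  overlapVolume-nonneg B Q = product-nonneg (λ i → 0≤y-x (clamp-mono (lower≤upper B i) (lower≤upper Q i)))

  overlapVolume-⊑ : ∀ {n} {B Q : Box n} → Q ⊑ B → overlapVolume B Q ≈ boxVolume Q
  overlapVolume-⊑ {B = B} {Q} Q⊑B = product-cong λ i →
    let l≤a = proj₁ (Q⊑B i); b≤u = proj₂ (Q⊑B i) in
    +-cong (clamp-inside (≤-trans l≤a (lower≤upper Q i)) b≤u)
           (-‿cong (clamp-inside l≤a (≤-trans (lower≤upper Q i) b≤u)))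

  module _ {n} (B : ℕ → Box n) where

    covered : Box n → ℕ → ℝ
    covered Q = partialSum (λ k → overlapVolume (B k) Q)

    -- The sum of the series is never formed. The positive gap `boxVolume Q - s` is the amount of
    -- volume that may later be cut away.
    Deficient : Box n → Set
    Deficient Q = ∃[ s ] s < boxVolume Q × (∀ m → covered Q m ≤ s)

    covered-mono-≤ : ∀ Q m d → covered Q m ≤ covered Q (m ℕ.+ d)
    covered-mono-≤ Q = partialSum-mono-≤ (λ k → overlapVolume-nonneg (B k) Q)

    covered-nonneg : ∀ Q m → 0# ≤ covered Q m
    covered-nonneg Q m = covered-mono-≤ Q 0 m

    deficient⇒0<volume : ∀ {Q} → Deficient Q → 0# < boxVolume Q
    deficient⇒0<volume (s , s<V , covered≤s) = ≤-<-trans (covered≤s 0) s<V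

    module _ (Q : Box n) (i : Fin n) {c : ℝ} (l≤c : lower Q i ≤ c) (c≤u : c ≤ upper Q i) where

      private
        Q⁻ = below Q i l≤c
        Q⁺ = above Q i c≤u

      boxVolume-additive : boxVolume Q ≈ boxVolume Q⁻ + boxVolume Q⁺
      boxVolume-additive = stieltjes-additive Q i l≤c c≤u (const id)

      covered-additive : ∀ m → covered Q m ≈ covered Q⁻ m + covered Q⁺ m
      covered-additive m = trans
        (sum-cong-≋ {m} (λ k → stieltjes-additive Q i l≤c c≤u (clampTo (B (toℕ k)))))
        (∑-distrib-+ {m} _ _)

      -- Write the gap as `h + h` and try the volume minus `h` as the bound for each piece. If both
      -- bounds are exceeded, at `m` and at `m′`, then by additivity `covered Q (m + m′)` exceeds
      -- `s`.
      cut-deficient : Deficient Q → Deficient Q⁻ ⊎ Deficient Q⁺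
      cut-deficient (s , s<V , covered≤s) = halves (half (boxVolume Q - s) (0<y-x s<V))
        where
        v-h<v : ∀ {v h} → 0# < h → v - h < v
        v-h<v {v} {h} 0<h = <-from-gap 0<h (solve 2 (λ v h → v := v :- h :+ h) refl v h)
        halves : ∃[ h ] 0# < h × h + h ≈ boxVolume Q - s → Deficient Q⁻ ⊎ Deficient Q⁺
        halves (h , 0<h , 2h≈V-s)
          with em {∃[ m ] boxVolume Q⁻ - h < covered Q⁻ m}
             | em {∃[ m ] boxVolume Q⁺ - h < covered Q⁺ m}
        ... | no small⁻ | _ = inj₁ (_ , v-h<v 0<h , λ m → ≮⇒≥ (λ v<c → small⁻ (m , v<c)))
        ... | yes _ | no small⁺ = inj₂ (_ , v-h<v 0<h , λ m → ≮⇒≥ (λ v<c → small⁺ (m , v<c)))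
        ... | yes (m , large⁻) | yes (m′ , large⁺) =
          ⊥-elim (≤⇒≯ (covered≤s (m ℕ.+ m′)) (begin-strict
          s
            ≈⟨ solve 2 (λ s v → s := v :- (v :- s)) refl s _ ⟩
          boxVolume Q - (boxVolume Q - s)
            ≈⟨ +-cong boxVolume-additive (-‿cong (sym 2h≈V-s)) ⟩
          boxVolume Q⁻ + boxVolume Q⁺ - (h + h)
            ≈⟨ solve 3 (λ v w h → v :+ w :- (h :+ h) := v :- h :+ (w :- h)) refl _ _ h ⟩
          boxVolume Q⁻ - h + (boxVolume Q⁺ - h)
            <⟨ +-mono-<-≤ large⁻ (inj₁ large⁺) ⟩
          covered Q⁻ m + covered Q⁺ m′
            ≤⟨ +-mono-≤ (covered-mono-≤ Q⁻ m m′) (≤-trans (covered-mono-≤ Q⁺ m′ m)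
                 (inj₂ (reflexive (≡.cong (covered Q⁺) (ℕ.+-comm m′ m))))) ⟩
          covered Q⁻ (m ℕ.+ m′) + covered Q⁺ (m ℕ.+ m′)
            ≈⟨ covered-additive (m ℕ.+ m′) ⟨
          covered Q (m ℕ.+ m′) ∎))

      -- The same `s` still serves: the covered volume does not grow, and the volume that is lost is
      -- less than the gap.
      discard-above : (def : Deficient Q) → boxVolume Q⁺ < boxVolume Q - proj₁ def → Deficient Q⁻
      discard-above (s , s<V , covered≤s) thin = s ,
        <-from-gap (0<y-x thin) (begin-equality
          boxVolume Q⁻
            ≈⟨ solve 3 (λ v w s → v := s :+ (v :+ w :- s :- w)) refl _ _ s ⟩
          s + (boxVolume Q⁻ + boxVolume Q⁺ - s - boxVolume Q⁺)
            ≈⟨ +-congˡ (+-congʳ (+-congʳ boxVolume-additive)) ⟨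
          s + (boxVolume Q - s - boxVolume Q⁺) ∎) ,
        λ m → ≤-trans (≤-from-gap (covered-nonneg Q⁺ m) (covered-additive m)) (covered≤s m)

      discard-below : (def : Deficient Q) → boxVolume Q⁻ < boxVolume Q - proj₁ def → Deficient Q⁺
      discard-below (s , s<V , covered≤s) thin = s ,
        <-from-gap (0<y-x thin) (begin-equality
          boxVolume Q⁺
            ≈⟨ solve 3 (λ v w s → w := s :+ (v :+ w :- s :- v)) refl _ _ s ⟩
          s + (boxVolume Q⁻ + boxVolume Q⁺ - s - boxVolume Q⁻)
            ≈⟨ +-congˡ (+-congʳ (+-congʳ boxVolume-additive)) ⟨
          s + (boxVolume Q - s - boxVolume Q⁻) ∎) ,
        λ m → ≤-trans (≤-from-gap (covered-nonneg Q⁻ m) (trans (covered-additive m) (+-comm _ _)))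
                (covered≤s m)

    module _ (Q : Box n) (def : Deficient Q) (i : Fin n) where

      private
        a = lower Q i
        b = upper Q i
        slab = thin-slab i (λ k → 0≤y-x (lower≤upper Q k)) (deficient⇒0<volume {Q} def)
                 (0<y-x (proj₁ (proj₂ def)))
        d = proj₁ slab
        0<d = proj₁ (proj₂ slab)
        d≤b-a = proj₁ (proj₂ (proj₂ slab))
        thin = proj₂ (proj₂ (proj₂ slab))

      -- Boxes are closed, so a piece cut off along a facet of another box still touches that box.
      -- Removing a slab thinner than the gap separates the two.
      shrink-upper : ∃[ Q′ ] Q′ ⊑ Q × Deficient Q′ × upper Q′ i < b
      shrink-upper = below Q i a≤b-d , below-⊑ Q i a≤b-d b-d≤b ,
        discard-above Q i a≤b-d b-d≤b def (thin
          (trans (+-congˡ (-‿cong (reflexive (updateAt-updates i (lower Q)))))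
                 (solve 2 (λ b d → b :- (b :- d) := d) refl b d))
          (λ k k≢i → +-congˡ (-‿cong (reflexive (updateAt-minimal k i (lower Q) k≢i))))) ,
        <-from-gap 0<d (trans (solve 2 (λ b d → b := b :- d :+ d) refl b d)
          (+-congʳ (reflexive (≡.sym (updateAt-updates i (upper Q))))))
        where
        a≤b-d : a ≤ b - d
        a≤b-d = ≤-from-gap (0≤y-x d≤b-a)
          (solve 3 (λ a b d → b :- d := a :+ (b :- a :- d)) refl a b d)
        b-d≤b : b - d ≤ b
        b-d≤b = ≤-from-gap (inj₁ 0<d) (solve 2 (λ b d → b := b :- d :+ d) refl b d)

      shrink-lower : ∃[ Q′ ] Q′ ⊑ Q × Deficient Q′ × a < lower Q′ i
      shrink-lower = above Q i a+d≤b , above-⊑ Q i a+d≤b a≤a+d ,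
        discard-below Q i a≤a+d a+d≤b def (thin
          (trans (+-congʳ (reflexive (updateAt-updates i (upper Q))))
                 (solve 2 (λ a d → a :+ d :- a := d) refl a d))
          (λ k k≢i → +-congʳ (reflexive (updateAt-minimal k i (upper Q) k≢i)))) ,
        <-from-gap 0<d (reflexive (updateAt-updates i (lower Q)))
        where
        a+d≤b : a + d ≤ b
        a+d≤b = ≤-from-gap (0≤y-x d≤b-a)
          (solve 3 (λ a b d → b := a :+ d :+ (b :- a :- d)) refl a b d)
        a≤a+d : a ≤ a + d
        a≤a+d = x≤x+y (inj₁ 0<d)

    DisjointFrom : Box n → Box n → Set
    DisjointFrom C Q = ∀ x → x ∈ Inside Q → x ∉ Inside C

    Escape : Box n → Box n → Set
    Escape C Q = ∃[ Q′ ] Q′ ⊑ Q × Deficient Q′ × DisjointFrom C Q′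

    disjoint-upper : ∀ {C Q} i → upper Q i < lower C i → DisjointFrom C Q
    disjoint-upper i b<l x x∈Q x∈C =
      ≤⇒≯ (≤-trans (proj₁ (x∈C i)) (proj₂ (x∈Q i))) b<l

    disjoint-lower : ∀ {C Q} i → upper C i < lower Q i → DisjointFrom C Q
    disjoint-lower i u<a x x∈Q x∈C =
      ≤⇒≯ (≤-trans (proj₁ (x∈Q i)) (proj₂ (x∈C i))) u<a

    escape-⊑ : ∀ {C Q Q′} → Q ⊑ Q′ → Escape C Q → Escape C Q′
    escape-⊑ {Q = Q} {Q′} Q⊑Q′ (P , P⊑Q , rest) = P , ⊑-trans {P = P} {Q} {Q′} P⊑Q Q⊑Q′ , rest

    -- A computation that either stops with an escape or goes on in a smaller deficient box
    -- satisfying `P`; `refine-then` is its sequential composition.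
    Refine : Box n → Box n → (Box n → Set) → Set
    Refine C Q P = Escape C Q ⊎ ∃[ Q′ ] Q′ ⊑ Q × Deficient Q′ × P Q′

    refine-then : ∀ {C Q P P′} → Refine C Q P →
                  (∀ Q′ → Deficient Q′ → P Q′ → Refine C Q′ P′) → Refine C Q P′
    refine-then (inj₁ esc) next = inj₁ esc
    refine-then {C} {Q} {P} {P′} (inj₂ (Q₁ , Q₁⊑Q , def₁ , p)) next = continue (next Q₁ def₁ p)
      where
      continue : Refine C Q₁ P′ → Refine C Q P′
      continue (inj₁ esc) = inj₁ (escape-⊑ {C} {Q₁} {Q} Q₁⊑Q esc)
      continue (inj₂ (Q₂ , Q₂⊑Q₁ , rest)) = inj₂ (Q₂ , ⊑-trans {P = Q₂} {Q₁} {Q} Q₂⊑Q₁ Q₁⊑Q , rest)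

    module _ (C Q : Box n) (def : Deficient Q) (i : Fin n) where

      private
        a = lower Q i
        b = upper Q i
        l = lower C i
        u = upper C i

      cut-lower : Refine C Q (λ Q′ → l ≤ lower Q′ i)
      cut-lower = by-cases (<-or-≥ a l) (<-or-≥ b l)
        where
        by-cases : a < l ⊎ l ≤ a → b < l ⊎ l ≤ b → Refine C Q (λ Q′ → l ≤ lower Q′ i)
        by-cases (inj₂ l≤a) _          = inj₂ (Q , ⊑-refl {Q = Q} , def , l≤a)
        by-cases (inj₁ _)   (inj₁ b<l) =
          inj₁ (Q , ⊑-refl {Q = Q} , def , disjoint-upper {C} {Q} i b<l)
        -- The cut is made at the facet of `C` itself: the upper piece satisfies the bound with
        -- equality, and the lower one meets `C` at most in this facet until it is shrunk.
        by-cases (inj₁ a<l) (inj₂ l≤b) = [ escape⁻ , keep⁺ ]′ (cut-deficient Q i a≤l l≤b def)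
          where
          a≤l : a ≤ l
          a≤l = inj₁ a<l
          escape⁻ : Deficient (below Q i a≤l) → _
          escape⁻ def⁻ = let P , P⊑Q⁻ , defP , b<l = shrink-upper (below Q i a≤l) def⁻ i in
            inj₁ (P , ⊑-trans {P = P} {below Q i a≤l} {Q} P⊑Q⁻ (below-⊑ Q i a≤l l≤b) , defP ,
              disjoint-upper {C} {P} i (<-respʳ-≈ (reflexive (updateAt-updates i (upper Q))) b<l))
          keep⁺ : Deficient (above Q i l≤b) → _
          keep⁺ def⁺ = inj₂ (above Q i l≤b , above-⊑ Q i l≤b a≤l , def⁺ ,
            inj₂ (reflexive (≡.sym (updateAt-updates i (lower Q)))))

      cut-upper : Refine C Q (λ Q′ → upper Q′ i ≤ u)
      cut-upper = by-cases (<-or-≥ u b) (<-or-≥ u a)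
        where
        by-cases : u < b ⊎ b ≤ u → u < a ⊎ a ≤ u → Refine C Q (λ Q′ → upper Q′ i ≤ u)
        by-cases (inj₂ b≤u) _          = inj₂ (Q , ⊑-refl {Q = Q} , def , b≤u)
        by-cases (inj₁ _)   (inj₁ u<a) =
          inj₁ (Q , ⊑-refl {Q = Q} , def , disjoint-lower {C} {Q} i u<a)
        by-cases (inj₁ u<b) (inj₂ a≤u) = [ keep⁻ , escape⁺ ]′ (cut-deficient Q i a≤u u≤b def)
          where
          u≤b : u ≤ b
          u≤b = inj₁ u<b
          keep⁻ : Deficient (below Q i a≤u) → _
          keep⁻ def⁻ = inj₂ (below Q i a≤u , below-⊑ Q i a≤u u≤b , def⁻ ,
            inj₂ (reflexive (updateAt-updates i (upper Q))))
          escape⁺ : Deficient (above Q i u≤b) → _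
          escape⁺ def⁺ = let P , P⊑Q⁺ , defP , u<a = shrink-lower (above Q i u≤b) def⁺ i in
            inj₁ (P , ⊑-trans {P = P} {above Q i u≤b} {Q} P⊑Q⁺ (above-⊑ Q i u≤b a≤u) , defP ,
              disjoint-lower {C} {P} i (<-respˡ-≈ (reflexive (updateAt-updates i (lower Q))) u<a))

    -- The bound won by the first cut survives the second, since lower ends only rise in a smaller
    -- box.
    cut-coordinate : ∀ C Q → Deficient Q → ∀ i →
                     Refine C Q (λ Q′ → lower C i ≤ lower Q′ i × upper Q′ i ≤ upper C i)
    cut-coordinate C Q def i = refine-then {C} {Q} (cut-lower C Q def i) λ Q₁ def₁ l≤a →
      map₂ (λ { (Q₂ , Q₂⊑Q₁ , def₂ , b≤u) →
                Q₂ , Q₂⊑Q₁ , def₂ , ≤-trans l≤a (proj₁ (Q₂⊑Q₁ i)) , b≤u })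
        (cut-upper C Q₁ def₁ i)

    -- The list `e` of coordinates allows induction on its length while the dimension stays fixed;
    -- it is applied to `id`.
    cut-all : ∀ C Q → Deficient Q → ∀ {k} (e : Fin k → Fin n) →
              Refine C Q (λ Q′ → ∀ j →
                lower C (e j) ≤ lower Q′ (e j) × upper Q′ (e j) ≤ upper C (e j))
    cut-all C Q def {zero}  e = inj₂ (Q , ⊑-refl {Q = Q} , def , λ ())
    cut-all C Q def {suc k} e = refine-then {C} {Q} (cut-all C Q def (e ∘ suc)) λ Q₁ def₁ within₁ →
      map₂ (λ { (Q₂ , Q₂⊑Q₁ , def₂ , within₀) → Q₂ , Q₂⊑Q₁ , def₂ ,
          λ { zero    → within₀
            ; (suc j) → ≤-trans (proj₁ (within₁ j)) (proj₁ (Q₂⊑Q₁ (e (suc j)))) ,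
                        ≤-trans (proj₂ (Q₂⊑Q₁ (e (suc j)))) (proj₂ (within₁ j)) } })
        (cut-coordinate C Q₁ def₁ (e zero))

    escape : ∀ k Q → Deficient Q → Escape (B k) Q
    escape k Q def = [ id , inside⇒escape ]′ (cut-all (B k) Q def id)
      where
      inside⇒escape : ∃[ Q′ ] Q′ ⊑ Q × Deficient Q′ × Q′ ⊑ B k → Escape (B k) Q
      inside⇒escape (Q′ , _ , (s , s<V , covered≤s) , Q′⊑B) =
        -- Inside `B k` the single overlap with `B k` is already the whole volume. Its term first
        -- enters the partial sum of length `suc k`.
        ⊥-elim (≤⇒≯ (covered≤s (suc k)) (begin-strict
        s                        <⟨ s<V ⟩
        boxVolume Q′             ≈⟨ overlapVolume-⊑ {B = B k} {Q′} Q′⊑B ⟨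
        overlapVolume (B k) Q′   ≤⟨ term≤partialSum (λ k → overlapVolume-nonneg (B k) Q′) k ⟩
        covered Q′ (suc k)       ∎))

    module _ (Q : Box n) (def : Deficient Q) where

      private
        descend : ℕ → ∃[ Q′ ] Deficient Q′
        descend zero    = Q , def
        descend (suc k) = let Q′ , def′ = descend k; P , _ , defP , _ = escape k Q′ def′ in P , defP

        box : ℕ → Box n
        box k = proj₁ (descend k)

        nested : ∀ k d → box (d ℕ.+ k) ⊑ box k
        nested k zero    = ⊑-refl {Q = box k}
        nested k (suc d) = ⊑-trans {P = box (suc (d ℕ.+ k))} {box (d ℕ.+ k)} {box k}
          (proj₁ (proj₂ (uncurry (escape (d ℕ.+ k)) (descend (d ℕ.+ k))))) (nested k d)

        lower≤upper-box : ∀ i k m → lower (box k) i ≤ upper (box m) i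
        -- Both ends are compared inside `box (m + k)`, which lies in `box k` and in `box m`.
        lower≤upper-box i k m = ≤-trans (proj₁ (nested k m i))
          (≤-trans (lower≤upper (box (m ℕ.+ k)) i)
          (≡.subst (λ j → upper (box j) i ≤ upper (box m) i) (ℕ.+-comm k m) (proj₂ (nested m k i))))

        supremum : ∀ i → ∃[ s ] IsSupremum _≤_ (λ y → ∃[ k ] y ≡ lower (box k) i) s
        supremum i = complete _ (_ , 0 , ≡.refl)
          (upper (box 0) i , λ { _ (k , ≡.refl) → lower≤upper-box i k 0 })

      -- The nested interval argument in each coordinate: the supremum of the lower ends is below
      -- every upper end. Stage `k` of the descent escapes from `B k`, so it is `box (suc k)` that
      -- is disjoint from `B k`.
      deficient⇒uncovered : ∃[ x ] x ∈ Inside Q × (∀ k → x ∉ Inside (B k))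
      deficient⇒uncovered = x , x∈box 0 , λ k → disjoint k x (x∈box (suc k))
        where
        x : Point n
        x i = proj₁ (supremum i)
        x∈box : ∀ k → x ∈ Inside (box k)
        x∈box k i = proj₁ (proj₂ (supremum i)) _ (k , ≡.refl) ,
                     proj₂ (proj₂ (supremum i)) _ (λ { _ (m , ≡.refl) → lower≤upper-box i m k })
        disjoint : ∀ k → DisjointFrom (B k) (box (suc k))
        disjoint k = proj₂ (proj₂ (proj₂ (uncurry (escape k) (descend k))))

-- Coding pairs by division with remainder.

module _ (N : ℕ) .{{_ : ℕ.NonZero N}} where

  -- This arranges infinitely many families of `N` boxes in one sequence, as `Covers` demands.
  pair : ℕ → Fin N → ℕ
  pair j r = toℕ r ℕ.+ j ℕ.* N

  pair-/ : ∀ j r → pair j r ℕ./ N ≡ j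
  pair-/ j r = ≡.trans (ℕ.+-distrib-/-∣ʳ (toℕ r) (divides-refl j))
    (≡.cong₂ ℕ._+_ (ℕ.m<n⇒m/n≡0 (toℕ<n r)) (ℕ.m*n/n≡m j N))

  pair-mod : ∀ j r → pair j r mod N ≡ r
  pair-mod j r = ≡.trans
    (fromℕ<-cong _ _ (≡.trans (ℕ.[m+kn]%n≡m%n (toℕ r) j N) (ℕ.m<n⇒m%n≡m (toℕ<n r))) _ (toℕ<n r))
    (fromℕ<-toℕ r _)

-- Balls, facets of boxes, and null sets.

module Boundaries (em : ExcludedMiddle 0ℓ) (R : CompleteOrderedField) where

  open Euclidean R
  open OrderedField R
  open BoxCovers em R
  open ≤-Reasoning
  open Box using (lower; upper; lower≤upper)

  -- A single square is at most the sum of squares; comparing it with `r * r` for both signs of the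
  -- difference gives the two bounds.
  Ball-coordinate : ∀ {n} (x y : Point n) {r} → 0# < r → y ∈ Ball x r → ∀ i →
                    x i - r < y i × y i < x i + r
  Ball-coordinate x y {r} 0<r y∈Ball i =
    <-from-gap (0<y-x (square-cancel-< 0<r (≤-<-trans (inj₂ flip-square) square<)))
      (solve 3 (λ x y r → y := x :- r :+ (r :- (x :- y))) refl (x i) (y i) r) ,
    <-from-gap (0<y-x (square-cancel-< 0<r square<))
      (solve 3 (λ x y r → x :+ r := y :+ (r :- (y :- x))) refl (x i) (y i) r)
    where
    flip-square : (x i - y i) * (x i - y i) ≈ (y i - x i) * (y i - x i)
    flip-square = solve 2 (λ x y → (x :- y) :* (x :- y) := (y :- x) :* (y :- x)) refl (x i) (y i)
    square< : (y i - x i) * (y i - x i) < r * r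
    square< = ≤-<-trans (term≤sum (λ k → 0≤x*x (y k - x k)) i) y∈Ball

  Ball-mono : ∀ {n} (x y : Point n) {r r′} → 0# < r → r ≤ r′ → y ∈ Ball x r → y ∈ Ball x r′
  Ball-mono x y 0<r r≤r′ y∈Ball = <-≤-trans y∈Ball (*-mono-≤ (inj₁ 0<r) (inj₁ 0<r) r≤r′ r≤r′)

  Separated : ∀ {n} → Point n → PointSet n → Set
  Separated x S = ∃[ r ] 0# < r × (∀ {y} → y ∈ Ball x r → y ∉ S)

  -- The radius is the amount by which some coordinate of `x` violates a bound of `Q`.
  outside-box : ∀ {n} (Q : Box n) {x} → x ∉ Inside Q → Separated x (Inside Q)
  outside-box {n} Q {x} x∉Q with em {∃[ i ] (x i < lower Q i ⊎ upper Q i < x i)}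
  ... | no  within = ⊥-elim (x∉Q λ i →
    ≮⇒≥ (λ x<l → within (i , inj₁ x<l)) , ≮⇒≥ (λ u<x → within (i , inj₂ u<x)))
  ... | yes (i , inj₁ x<l) = lower Q i - x i , 0<y-x x<l , λ {y} y∈Ball y∈Q → ≤⇒≯ (proj₁ (y∈Q i))
    (<-respʳ-≈ (solve 2 (λ x l → x :+ (l :- x) := l) refl (x i) (lower Q i))
      (proj₂ (Ball-coordinate x y (0<y-x x<l) y∈Ball i)))
  ... | yes (i , inj₂ u<x) = x i - upper Q i , 0<y-x u<x , λ {y} y∈Ball y∈Q → ≤⇒≯ (proj₂ (y∈Q i))
    (<-respˡ-≈ (solve 2 (λ x u → x :- (x :- u) := u) refl (x i) (upper Q i))
      (proj₁ (Ball-coordinate x y (0<y-x u<x) y∈Ball i)))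

  outside-boxes : ∀ {n} k (Q : Fin k → Box n) {x} → (∀ j → x ∉ Inside (Q j)) →
                  Separated x (λ y → ∃[ j ] y ∈ Inside (Q j))
  outside-boxes k Q {x} x∉Q =
    let r , 0<r , r≤ = positive-minorant (λ j → proj₁ (sep j)) (λ j → proj₁ (proj₂ (sep j))) in
    r , 0<r , λ { {y} y∈Ball (j , y∈Q) →
      proj₂ (proj₂ (sep j)) {y} (Ball-mono x y 0<r (r≤ j) y∈Ball) y∈Q }
    where sep = λ j → outside-box (Q j) (x∉Q j)

  Strictly : ∀ {n} → Box n → PointSet n
  Strictly Q x = ∀ i → lower Q i < x i × x i < upper Q i

  strictly⇒interior : ∀ {n} (Q : Box n) {x} → x ∈ Strictly Q → x ∈ Interior (Inside Q)
  strictly⇒interior Q {x} l<x<u =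
    let r , 0<r , r≤ = positive-minorant (λ i → x i - lower Q i) (λ i → 0<y-x (proj₁ (l<x<u i)))
        t , 0<t , t≤ = positive-minorant (λ i → upper Q i - x i) (λ i → 0<y-x (proj₂ (l<x<u i)))
        0<r⊓t = ⊓-pos 0<r 0<t
    in r ⊓ t , 0<r⊓t , λ {y} y∈Ball i →
      let x-r<y , y<x+r = Ball-coordinate x y 0<r⊓t y∈Ball i in
      inj₁ (≤-<-trans (≤-from-gap (0≤y-x (≤-trans (x⊓y≤x r t) (r≤ i)))
        (solve 3 (λ x l r → x :- r := l :+ (x :- l :- r)) refl (x i) (lower Q i) (r ⊓ t))) x-r<y) ,
      inj₁ (<-≤-trans y<x+r (≤-from-gap (0≤y-x (≤-trans (x⊓y≤y r t) (t≤ i)))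
        (solve 3 (λ x u r → u := x :+ r :+ (u :- x :- r)) refl (x i) (upper Q i) (r ⊓ t))))

  -- Cutting a box at one of its own ends leaves the facet there as a degenerate piece: `0F` is the
  -- lower facet, `1F` the upper one.
  face : ∀ {n} → Box n → Fin n × Fin 2 → Box n
  face Q (i , 0F) = below Q i {lower Q i} ≤-refl
  face Q (i , 1F) = above Q i {upper Q i} ≤-refl

  face-volume : ∀ {n} (Q : Box n) f → boxVolume (face Q f) ≈ 0#
  face-volume Q (i , 0F) = product-zero _ i
    (trans (+-congʳ (reflexive (updateAt-updates i (upper Q)))) (-‿inverseʳ (lower Q i)))
  face-volume Q (i , 1F) = product-zero _ i
    (trans (+-congˡ (-‿cong (reflexive (updateAt-updates i (lower Q))))) (-‿inverseʳ (upper Q i)))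

  not-strictly⇒face : ∀ {n} (Q : Box n) {x} → x ∈ Inside Q → x ∉ Strictly Q →
                      ∃[ f ] x ∈ Inside (face Q f)
  not-strictly⇒face Q {x} x∈Q not-strict with em {∃[ i ] (x i ≤ lower Q i ⊎ upper Q i ≤ x i)}
  ... | no  none = ⊥-elim (not-strict λ i →
    ≰⇒> (λ x≤l → none (i , inj₁ x≤l)) , ≰⇒> (λ u≤x → none (i , inj₂ u≤x)))
  ... | yes (i , inj₁ x≤l) = (i , 0F) , λ k → proj₁ (x∈Q k) , bound k (k Fin.≟ i)
    where
    bound : ∀ k → _ → x k ≤ updateAt (upper Q) i (const (lower Q i)) k
    bound k (yes ≡.refl) = ≤-trans x≤l (inj₂ (reflexive (≡.sym (updateAt-updates i (upper Q)))))
    bound k (no k≢i)     = ≤-trans (proj₂ (x∈Q k))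
      (inj₂ (reflexive (≡.sym (updateAt-minimal k i (upper Q) k≢i))))
  ... | yes (i , inj₂ u≤x) = (i , 1F) , λ k → bound k (k Fin.≟ i) , proj₂ (x∈Q k)
    where
    bound : ∀ k → _ → updateAt (lower Q) i (const (upper Q i)) k ≤ x k
    bound k (yes ≡.refl) = ≤-trans (inj₂ (reflexive (updateAt-updates i (lower Q)))) u≤x
    bound k (no k≢i)     = ≤-trans (inj₂ (reflexive (updateAt-minimal k i (lower Q) k≢i)))
      (proj₁ (x∈Q k))

  volumeless⇒null : ∀ {n} {S : PointSet n} (B : ℕ → Box n) → (∀ k → boxVolume (B k) ≈ 0#) →
                    Covers B S → LebesgueMeasure S [ 0# ]
  volumeless⇒null {n} {S} B volumeless covers =
    -- The empty partial sum is `0#`, so every total volume is at least `0#`.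
    (λ { t (_ , _ , total) → proj₁ total [ 0# ] (0 , ≡.refl) }) ,
    λ u u≤ → u≤ [ 0# ] (B , covers , (λ { _ (m , ≡.refl) → [ inj₂ (partial≈0 m) ] }) ,
      λ v ≤v → ≤v [ 0# ] (0 , ≡.refl))
    where
    partial≈0 : ∀ m → partialVolume B m ≈ 0#
    partial≈0 m = trans (sum-cong-≋ {m} (λ k → volumeless (toℕ k))) (sum-replicate-zero m)

-- The staircase: infinite volume and null boundary.

module Staircase (em : ExcludedMiddle 0ℓ) (R : CompleteOrderedField) where

  open Euclidean R
  open OrderedField R
  open BoxCovers em R
  open Boundaries em R
  open ≤-Reasoning
  open Box using (lower; upper; lower≤upper)

  module _ (c : ℝ) (0<c : 0# < c) (m : ℕ) where

    private
      n : ℕ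
      n = suc (suc m)

    height : ℕ → ℝ
    height j = c * proj₁ (positive-inverse (2^-pos j))

    height-pos : ∀ j → 0# < height j
    height-pos j = *-pos 0<c (proj₁ (proj₂ (positive-inverse (2^-pos j))))

    2^*height : ∀ j → 2^ j * height j ≈ c
    2^*height j = begin-equality
      2^ j * (c * z)  ≈⟨ solve 3 (λ p c z → p :* (c :* z) := c :* (p :* z)) refl (2^ j) c z ⟩
      c * (2^ j * z)  ≈⟨ *-congˡ (proj₂ (proj₂ (positive-inverse (2^-pos j)))) ⟩
      c * 1#          ≈⟨ *-identityʳ c ⟩
      c               ∎
      where z = proj₁ (positive-inverse (2^-pos j))

    step : ℕ → Box n
    step j = record
      { lower       = λ { zero → 2^ j ; (suc _) → 0# }
      -- The height belongs to the right end `2^ (suc j)`, so the far corner lies on the hyperbola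
      -- x₀ x₁ = c and the rest of the step below it.
      ; upper       = λ { zero → 2^ (suc j) ; (suc zero) → height (suc j) ; (suc (suc _)) → 1# }
      ; lower≤upper = λ { zero          → 2^-step j
                        ; (suc zero)    → inj₁ (height-pos (suc j))
                        ; (suc (suc _)) → inj₁ 0<1 }
      }

    staircase : PointSet n
    staircase x = ∃[ j ] x ∈ Inside (step j)

    staircase-resp : staircase Respects _≋_
    staircase-resp x≋y (j , x∈Q) = j , λ i →
      ≤-trans (proj₁ (x∈Q i)) (inj₂ (x≋y i)) , ≤-trans (inj₂ (sym (x≋y i))) (proj₂ (x∈Q i))

    -- Doubling the width `2^ j` gives `2^ (suc j)`, whose product with `height (suc j)` is `c`. The
    -- doubled form avoids a division by two.
    step-volume : ∀ j → boxVolume (step j) + boxVolume (step j) ≈ c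
    step-volume j = begin-equality
      V + V                                          ≈⟨ +-cong V≈ V≈ ⟩
      2^ j * height (suc j) + 2^ j * height (suc j)  ≈⟨ distribʳ _ (2^ j) (2^ j) ⟨
      2^ (suc j) * height (suc j)                    ≈⟨ 2^*height (suc j) ⟩
      c                                              ∎
      where
      V = boxVolume (step j)
      x-0≈x : ∀ x → x - 0# ≈ x
      x-0≈x x = trans (+-congˡ -0#≈0#) (+-identityʳ x)
      V≈ : V ≈ 2^ j * height (suc j)
      V≈ = *-cong (solve 1 (λ x → x :+ x :- x := x) refl (2^ j))
        (trans (*-cong (x-0≈x _) (trans (product-cong {m} (λ _ → x-0≈x 1#)) (product-one m)))
          (*-identityʳ _))

    module _ (B : Box n) where

      private
        crossSection = product (λ i → upper B (suc i) - lower B (suc i))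
        crossSection-nonneg : 0# ≤ crossSection
        crossSection-nonneg = product-nonneg (λ i → 0≤y-x (lower≤upper B (suc i)))

      -- The volume of the part of B in the slab s ≤ x₀ ≤ t.
      slabVolume : ℝ → ℝ → ℝ
      slabVolume s t = (clampTo B zero t - clampTo B zero s) * crossSection

      slabVolume-nonneg : ∀ {s t} → s ≤ t → 0# ≤ slabVolume s t
      slabVolume-nonneg s≤t = 0≤x*y
        (0≤y-x (clamp-mono (lower≤upper B zero) s≤t)) crossSection-nonneg

      slabVolume-additive : ∀ r s t → slabVolume r t ≈ slabVolume r s + slabVolume s t
      slabVolume-additive r s t = solve 4
        (λ x y z p → (z :- x) :* p := (y :- x) :* p :+ (z :- y) :* p) refl
        (clampTo B zero r) (clampTo B zero s) (clampTo B zero t) crossSection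

      clamp-difference : ∀ i s t → clampTo B i t - clampTo B i s ≤ upper B i - lower B i
      clamp-difference i s t =
        +-mono-≤ (clamp-upper (lower≤upper B i) t) (neg-mono-≤ (clamp-lower (lower≤upper B i) s))

      slabVolume≤boxVolume : ∀ s t → slabVolume s t ≤ boxVolume B
      slabVolume≤boxVolume s t = *-monoʳ-≤ crossSection-nonneg (clamp-difference zero s t)

      -- The steps lie in consecutive slabs of x₀. By `slabVolume-additive` these bounds telescope
      -- over `j`, so a box contributes at most its own volume to all steps together.
      overlapVolume-step≤slabVolume : ∀ j →
        overlapVolume B (step j) ≤ slabVolume (2^ j) (2^ (suc j))
      overlapVolume-step≤slabVolume j = *-monoˡ-≤
        (0≤y-x (clamp-mono (lower≤upper B zero) (2^-step j)))
        (product-mono (λ i → 0≤y-x (clamp-mono (lower≤upper B (suc i))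
                                               (lower≤upper (step j) (suc i))))
                      (λ i → clamp-difference (suc i) _ _))

    staircase-infiniteVolume : InfiniteVolume staircase
    staircase-infiniteVolume = (λ { t (B , covers , total) → infinite B covers t total }) ,
                               λ u _ → u ≤⊤⁺
      where
      -- Here `s` is c/2, the volume of a step, and `q` is c/4: a bound strictly below that volume,
      -- as `Deficient` demands.
      s = proj₁ (half c 0<c)
      quarter = half s (proj₁ (proj₂ (half c 0<c)))
      q = proj₁ quarter
      0<q = proj₁ (proj₂ quarter)

      q<volume : ∀ j → q < boxVolume (step j)
      q<volume j = ≰⇒> λ V≤q → ≤⇒≯
        (begin
          c                    ≈⟨ step-volume j ⟨
          V + V                ≤⟨ +-mono-≤ V≤q V≤q ⟩
          q + q                ≈⟨ proj₂ (proj₂ quarter) ⟩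
          s                    ∎)
        (<-from-gap (proj₁ (proj₂ (half c 0<c))) (sym (proj₂ (proj₂ (half c 0<c)))))
        where V = boxVolume (step j)

      module _ (B : ℕ → Box n) (covers : Covers B staircase) where

        -- Otherwise `q` would witness that the step is deficient, and the step would contain an
        -- uncovered point.
        mostlyCovered : ∀ j → ∃[ k ] q < covered B (step j) k
        mostlyCovered j with em {∃[ k ] q < covered B (step j) k}
        ... | yes found = found
        ... | no  none  =
          let x , x∈Q , x∉B = deficient⇒uncovered B (step j)
                (q , q<volume j , λ k → ≮⇒≥ (λ q<c → none (k , q<c)))
              k , x∈Bk = covers x (j , x∈Q)
          in ⊥-elim (x∉B k x∈Bk)

        slabs : ℝ → ℝ → ℕ → ℝ
        slabs s t = partialSum (λ k → slabVolume (B k) s t)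

        slabs-mono : ∀ {s t} → s ≤ t → ∀ k d → slabs s t k ≤ slabs s t (k ℕ.+ d)
        slabs-mono s≤t = partialSum-mono-≤ (λ k → slabVolume-nonneg (B k) s≤t)

        -- Each further step adds `q` in a new slab. Different steps may need different numbers of
        -- boxes; since the terms are nonnegative, `k + k′` boxes serve both.
        growth : ∀ N → ∃[ k ] N · q ≤ slabs (2^ 0) (2^ N) k
        growth zero    = 0 , ≤-refl
        growth (suc N) = let k , Nq≤ = growth N; k′ , q<covered = mostlyCovered N in
          k ℕ.+ k′ , (begin
          q + N · q
            ≈⟨ +-comm q (N · q) ⟩
          N · q + q
            ≤⟨ +-mono-≤ Nq≤ (inj₁ q<covered) ⟩
          slabs (2^ 0) (2^ N) k + covered B (step N) k′
            ≤⟨ +-monoʳ-≤ _ (sum-mono {k′} (λ i → overlapVolume-step≤slabVolume (B (toℕ i)) N)) ⟩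
          slabs (2^ 0) (2^ N) k + slabs (2^ N) (2^ (suc N)) k′
            ≤⟨ +-mono-≤ (slabs-mono (1≤2^ N) k k′) (≤-trans (slabs-mono (2^-step N) k′ k)
                 (inj₂ (reflexive (≡.cong (slabs (2^ N) (2^ (suc N))) (ℕ.+-comm k′ k))))) ⟩
          slabs (2^ 0) (2^ N) (k ℕ.+ k′) + slabs (2^ N) (2^ (suc N)) (k ℕ.+ k′)
            ≈⟨ ∑-distrib-+ {k ℕ.+ k′} _ _ ⟨
          sum {k ℕ.+ k′} (λ i → slabVolume (B (toℕ i)) (2^ 0) (2^ N) +
                                slabVolume (B (toℕ i)) (2^ N) (2^ (suc N)))
            ≈⟨ sum-cong-≋ {k ℕ.+ k′} (λ i →
                 slabVolume-additive (B (toℕ i)) (2^ 0) (2^ N) (2^ (suc N))) ⟨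
          slabs (2^ 0) (2^ (suc N)) (k ℕ.+ k′) ∎)

        infinite : ∀ t → TotalVolume B t → +∞ ≤⁺ t
        infinite ⊤⁺    _             = ⊤⁺ ≤⊤⁺
        -- A finite total `r` is exceeded by some `N · q`, although finitely many boxes of the cover
        -- have at least that volume.
        infinite [ r ] (partial≤r , _) = ⊥-elim (≤⇒≯
          (bounded (partial≤r _ (proj₁ reached , ≡.refl)))
          (proj₂ exceeded))
          where
          exceeded = archimedean em 0<q r
          N = proj₁ exceeded
          reached = growth N
          k = proj₁ reached
          bounded : [ partialVolume B k ] ≤⁺ [ r ] → N · q ≤ r
          bounded [ partial≤r ] = begin
            N · q                   ≤⟨ proj₂ reached ⟩
            slabs (2^ 0) (2^ N) k   ≤⟨ sum-mono {k} (λ i →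
                                         slabVolume≤boxVolume (B (toℕ i)) (2^ 0) (2^ N)) ⟩
            partialVolume B k       ≤⟨ partial≤r ⟩
            r                       ∎

    -- The union of closed boxes is locally finite: if x₀ < `2^ J`, all steps from index `J` on
    -- avoid the ball of radius `2^ J` minus x₀ around `x`, and the finitely many earlier ones are
    -- handled by `outside-boxes`.
    staircase-closed : ∀ {x} → x ∈ Closure staircase → x ∈ staircase
    staircase-closed {x} x∈Closure with em {x ∈ staircase}
    ... | yes x∈staircase = x∈staircase
    ... | no  x∉staircase = let y , y∈Ball , y∈staircase = x∈Closure r 0<r in
            ⊥-elim (avoids {y} y∈Ball y∈staircase)
      where
      beyond : ∃[ J ] x zero < 2^ J
      beyond = let J , x₀<J = archimedean em 0<1 (x zero) in J , <-≤-trans x₀<J (n≤2^n J)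
      J = proj₁ beyond
      0<2^J-x₀ = 0<y-x (proj₂ beyond)
      sep = outside-boxes J (λ j → step (toℕ j)) (λ j x∈Q → x∉staircase (toℕ j , x∈Q))
      r = proj₁ sep ⊓ (2^ J - x zero)
      0<r = ⊓-pos (proj₁ (proj₂ sep)) 0<2^J-x₀
      avoids : ∀ {y} → y ∈ Ball x r → y ∉ staircase
      avoids {y} y∈Ball (j , y∈Q) with j ℕ.<? J
      ... | yes j<J = proj₂ (proj₂ sep) {y} (Ball-mono x y 0<r (x⊓y≤x _ _) y∈Ball)
              (fromℕ< j<J , ≡.subst (λ k → y ∈ Inside (step k)) (≡.sym (toℕ-fromℕ< j<J)) y∈Q)
      ... | no  j≮J = ≤⇒≯
              (begin
                2^ J               ≤⟨ 2^-mono J (j ℕ.∸ J) ⟩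
                2^ (j ℕ.∸ J ℕ.+ J) ≡⟨ ≡.cong 2^ (ℕ.m∸n+n≡m (ℕ.≮⇒≥ j≮J)) ⟩
                2^ j               ≤⟨ proj₁ (y∈Q zero) ⟩
                y zero             ∎)
              (<-respʳ-≈ (solve 2 (λ x a → x :+ (a :- x) := a) refl (x zero) (2^ J))
                (proj₂ (Ball-coordinate x y 0<2^J-x₀ (Ball-mono x y 0<r (x⊓y≤y _ _) y∈Ball) zero)))

    -- The quotient of `k` by the number `n * 2` of facets selects the step, the remainder selects
    -- the coordinate and the end.
    faces : ℕ → Box n
    faces k = face (step (k ℕ./ (n ℕ.* 2))) (remQuot 2 (k mod (n ℕ.* 2)))

    -- By closedness a boundary point lies in some step, and it cannot lie strictly inside, for then
    -- it would be interior to the staircase.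
    faces-cover : Covers faces (Boundary staircase)
    faces-cover x (x∈Closure , x∉Interior) =
      let j , x∈Q = staircase-closed x∈Closure
          (i , e) , x∈face = not-strictly⇒face (step j) x∈Q λ l<x<u →
            let r , 0<r , Ball⊆Q = strictly⇒interior (step j) l<x<u
            in x∉Interior (r , 0<r , λ {y} y∈Ball → j , Ball⊆Q {y} y∈Ball)
          k = pair (n ℕ.* 2) j (combine i e)
      in k , ≡.subst (λ Q → x ∈ Inside Q)
        (≡.sym (≡.cong₂ (λ j f → face (step j) f) (pair-/ (n ℕ.* 2) j (combine i e))
          (≡.trans (≡.cong (remQuot 2) (pair-mod (n ℕ.* 2) j (combine i e)))
            (remQuot-combine i e))))
        x∈face

    staircase-jordanMeasurable : JordanMeasurable staircase
    staircase-jordanMeasurable = volumeless⇒null faces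
      (λ k → face-volume (step (k ℕ./ (n ℕ.* 2))) (remQuot 2 (k mod (n ℕ.* 2)))) faces-cover

-- Determinant bounds and vertices of parallelotopes.

lookup-⊥ : ∀ {n} (j : Fin n) → lookup (⊥ {n}) j ≡ outside
lookup-⊥ j = lookup-replicate j outside

module Determinants (R : CompleteOrderedField) where

  open Euclidean R
  open OrderedField R
  open ≤-Reasoning

  factorial : ℕ → ℝ
  factorial zero    = 1#
  factorial (suc n) = suc n · factorial n

  factorial-nonneg : ∀ n → 0# ≤ factorial n
  factorial-nonneg zero    = inj₁ 0<1
  factorial-nonneg (suc n) = 0≤n·x (suc n) (factorial-nonneg n)

  ∣±x∣≤∣x∣ : ∀ k x → ∣ (- 1#) ^ k * x ∣ ≤ ∣ x ∣
  ∣±x∣≤∣x∣ zero    x = ∣∣-cong (*-identityˡ x)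
  ∣±x∣≤∣x∣ (suc k) x = begin
    ∣ - 1# * (- 1#) ^ k * x ∣  ≤⟨ ∣∣-cong (trans (*-assoc _ _ _)
                                    (trans (sym (-‿distribˡ-* 1# _)) (-‿cong (*-identityˡ _)))) ⟩
    ∣ - ((- 1#) ^ k * x) ∣     ≤⟨ ∣-x∣≤∣x∣ _ ⟩
    ∣ (- 1#) ^ k * x ∣         ≤⟨ ∣±x∣≤∣x∣ k x ⟩
    ∣ x ∣                      ∎

  ∣det∣≤factorial : ∀ {n} (M : Vector (Vector ℝ n) n) → (∀ i j → ∣ M i j ∣ ≤ 1#) →
                    ∣ det M ∣ ≤ factorial n
  ∣det∣≤factorial {zero}  M M≤1 = ∣∣-least ≤-refl
    (≤-trans (neg-mono-≤ (inj₁ 0<1)) (≤-trans (inj₂ -0#≈0#) (inj₁ 0<1)))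
  ∣det∣≤factorial {suc n} M M≤1 = ∣sum∣≤ _ λ j →
    let D = det (λ i → removeAt (M (suc i)) j) in begin
    ∣ (- 1#) ^ toℕ j * M zero j * D ∣    ≤⟨ ∣∣-cong (*-assoc _ _ _) ⟩
    ∣ (- 1#) ^ toℕ j * (M zero j * D) ∣  ≤⟨ ∣±x∣≤∣x∣ (toℕ j) _ ⟩
    ∣ M zero j * D ∣                     ≤⟨ ∣x*y∣≤∣x∣*∣y∣ (M zero j) D ⟩
    ∣ M zero j ∣ * ∣ D ∣                 ≤⟨ *-mono-≤ (0≤∣x∣ _) (0≤∣x∣ D) (M≤1 zero j)
                                              (∣det∣≤factorial _ (λ i k → M≤1 (suc i) (punchIn j k))) ⟩
    1# * factorial n                     ≈⟨ *-identityˡ _ ⟩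
    factorial n                          ∎

  -- Expanding along two rows gives (m+2)(m+1) terms, each a product of entries of these rows in
  -- different columns, bounded by `c`, with a minor of the remaining rows, bounded by m!. The
  -- hypothesis concerns products because the staircase is unbounded in x₀.
  ∣det∣≤c*factorial : ∀ {m} (M : Vector (Vector ℝ (suc (suc m))) (suc (suc m))) {c} →
                      (∀ j k → k ≢ j → ∣ M zero j * M (suc zero) k ∣ ≤ c) →
                      (∀ i j → ∣ M (suc (suc i)) j ∣ ≤ 1#) →
                      ∣ det M ∣ ≤ c * factorial (suc (suc m))
  ∣det∣≤c*factorial {m} M {c} M₀M₁≤c M≤1 = begin
    ∣ det M ∣                                    ≤⟨ ∣sum∣≤ _ first-row ⟩
    suc (suc m) · (suc m · (c * factorial m))    ≈⟨ ×-congʳ (suc (suc m))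
                                                      (×-comm-* (suc m) c (factorial m)) ⟨
    suc (suc m) · (c * factorial (suc m))        ≈⟨ ×-comm-* (suc (suc m)) c (factorial (suc m)) ⟨
    c * factorial (suc (suc m))                  ∎
    where
    D₂ : Fin (suc (suc m)) → Fin (suc m) → ℝ
    D₂ j k = det (λ i → removeAt (removeAt (M (suc (suc i))) j) k)
    entry : Fin (suc (suc m)) → Fin (suc m) → ℝ
    entry j k = M (suc zero) (punchIn j k)
    second-row : ∀ j k → ∣ M zero j * ((- 1#) ^ toℕ k * entry j k * D₂ j k) ∣ ≤ c * factorial m
    second-row j k = begin
      ∣ M zero j * ((- 1#) ^ toℕ k * entry j k * D₂ j k) ∣
        ≤⟨ ∣∣-cong (solve 4 (λ a s b d → a :* (s :* b :* d) := s :* (a :* b :* d)) refl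
             (M zero j) ((- 1#) ^ toℕ k) (entry j k) (D₂ j k)) ⟩
      ∣ (- 1#) ^ toℕ k * (M zero j * entry j k * D₂ j k) ∣
        ≤⟨ ∣±x∣≤∣x∣ (toℕ k) _ ⟩
      ∣ M zero j * entry j k * D₂ j k ∣
        ≤⟨ ∣x*y∣≤∣x∣*∣y∣ (M zero j * entry j k) (D₂ j k) ⟩
      ∣ M zero j * entry j k ∣ * ∣ D₂ j k ∣
        ≤⟨ *-mono-≤ (0≤∣x∣ _) (0≤∣x∣ (D₂ j k)) (M₀M₁≤c j (punchIn j k) (punchInᵢ≢i j k))
             (∣det∣≤factorial _ (λ i l → M≤1 i (punchIn j (punchIn k l)))) ⟩
      c * factorial m ∎
    first-row : ∀ j → ∣ (- 1#) ^ toℕ j * M zero j * det (λ i → removeAt (M (suc i)) j) ∣ ≤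
                      suc m · (c * factorial m)
    first-row j = begin
      ∣ (- 1#) ^ toℕ j * M zero j * D ∣    ≤⟨ ∣∣-cong (*-assoc _ _ _) ⟩
      ∣ (- 1#) ^ toℕ j * (M zero j * D) ∣  ≤⟨ ∣±x∣≤∣x∣ (toℕ j) _ ⟩
      -- The entry of the first row moves inside the second expansion before absolute values are
      -- estimated, so that it meets the entries of the second row.
      ∣ M zero j * D ∣                     ≤⟨ ∣∣-cong (*-distribˡ-sum (M zero j) terms) ⟩
      ∣ sum (λ k → M zero j * terms k) ∣   ≤⟨ ∣sum∣≤ _ (second-row j) ⟩
      suc m · (c * factorial m)            ∎
      where
      terms : Vector ℝ (suc m)
      terms k = (- 1#) ^ toℕ k * entry j k * D₂ j k
      D = det (λ i → removeAt (M (suc i)) j)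

  -- Only summand `j` changes, from `0#` to the edge. This exhibits each edge vector as a difference
  -- of two vertices in many ways.
  vertex-insert : ∀ {n} (P : Parallelotope n) T j → lookup T j ≡ outside → ∀ i →
                  vertex P (T [ j ]≔ inside) i ≈ vertex P T i + Parallelotope.edge P j i
  vertex-insert {suc n} P T j j∉T i = begin-equality
    base i + sum (terms T′)
      ≈⟨ +-congˡ (sum-remove {i = j} (terms T′)) ⟩
    base i + (terms T′ j + sum (removeAt (terms T′) j))
      ≈⟨ +-congˡ (+-cong
           (reflexive (≡.cong (if_then edge j i else 0#) (lookup∘update j T inside)))
           (sum-cong-≋ (λ k → reflexive (≡.cong (if_then edge (punchIn j k) i else 0#)
             (lookup∘update′ (punchInᵢ≢i j k) T inside))))) ⟩
    base i + (edge j i + rest)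
      ≈⟨ solve 3 (λ b e r → b :+ (e :+ r) := b :+ (con (ℤ.+ 0) :+ r) :+ e) refl _ _ rest ⟩
    base i + (0# + rest) + edge j i
      ≡⟨ ≡.cong (λ b → base i + ((if b then edge j i else 0#) + rest) + edge j i) j∉T ⟨
    base i + (terms T j + rest) + edge j i
      ≈⟨ +-congʳ (+-congˡ (sum-remove {i = j} (terms T))) ⟨
    base i + sum (terms T) + edge j i ∎
    where
    open Parallelotope P using (base; edge)
    T′ : Subset (suc n)
    T′ = T [ j ]≔ inside
    terms : Subset (suc n) → Vector ℝ (suc n)
    terms T k = if lookup T k then edge k i else 0#
    rest : ℝ
    rest = sum (removeAt (terms T) j)

-- Volumes of parallelotopes with vertices in the staircase.

module Volumes (em : ExcludedMiddle 0ℓ) (R : CompleteOrderedField) where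

  open Euclidean R
  open OrderedField R
  open Determinants R
  open Staircase em R
  open ≤-Reasoning

  module _ {c : ℝ} (0<c : 0# < c) {m : ℕ} where

    private
      A = staircase c 0<c m

    0≤x₀ : ∀ {x} → x ∈ A → 0# ≤ x zero
    0≤x₀ (j , x∈Q) = ≤-trans (inj₁ (2^-pos j)) (proj₁ (x∈Q zero))

    0≤x₁ : ∀ {x} → x ∈ A → 0# ≤ x (suc zero)
    0≤x₁ (j , x∈Q) = proj₁ (x∈Q (suc zero))

    x₀x₁≤c : ∀ {x} → x ∈ A → x zero * x (suc zero) ≤ c
    x₀x₁≤c {x} x∈A@(j , x∈Q) = ≤-trans
      (*-mono-≤ (0≤x₀ {x} x∈A) (0≤x₁ {x} x∈A) (proj₂ (x∈Q zero)) (proj₂ (x∈Q (suc zero))))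
      (inj₂ (2^*height c 0<c m (suc j)))

    -- Since x₁ and y₁ are nonnegative, t is at most y₁ and its negative at most x₁. As s is at most
    -- both x₀ and y₀, the hyperbola bound at `y` or at `x` applies.
    ∣s*t∣≤c : ∀ {x y s t} → x ∈ A → y ∈ A → 0# ≤ s → s ≤ x zero → s ≤ y zero →
              y (suc zero) ≈ x (suc zero) + t → ∣ s * t ∣ ≤ c
    ∣s*t∣≤c {x} {y} {s} {t} x∈A y∈A 0≤s s≤x₀ s≤y₀ y₁≈x₁+t = ∣∣-least
      (begin
        s * t                  ≤⟨ *-monoˡ-≤ 0≤s (≤-from-gap (0≤x₁ {x} x∈A)
                                    (trans y₁≈x₁+t (+-comm _ t))) ⟩
        s * y (suc zero)       ≤⟨ *-monoʳ-≤ (0≤x₁ {y} y∈A) s≤y₀ ⟩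
        y zero * y (suc zero)  ≤⟨ x₀x₁≤c {y} y∈A ⟩
        c                      ∎)
      (begin
        - (s * t)              ≈⟨ solve 2 (λ s t → :- (s :* t) := s :* :- t) refl s t ⟩
        s * - t                ≤⟨ *-monoˡ-≤ 0≤s (≤-from-gap (0≤x₁ {y} y∈A)
                                    (trans (solve 2 (λ x t → x := :- t :+ (x :+ t)) refl _ t)
                                      (+-congˡ (sym y₁≈x₁+t)))) ⟩
        s * x (suc zero)       ≤⟨ *-monoʳ-≤ (0≤x₁ {x} x∈A) s≤x₀ ⟩
        x zero * x (suc zero)  ≤⟨ x₀x₁≤c {x} x∈A ⟩
        c                      ∎)

    module _ (P : Parallelotope (suc (suc m))) (vertices∈A : ∀ T → vertex P T ∈ A) where

      open Parallelotope P using (edge)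

      -- The entry is the difference of a coordinate at two vertices, and both values lie in [0,1].
      ∣edge∣≤1 : ∀ i j → ∣ edge j (suc (suc i)) ∣ ≤ 1#
      ∣edge∣≤1 i j = ∣∣-least
        (≤-trans (≤-from-gap (proj₁ (bounds ⊥)) (trans q≈p+e (+-comm _ _)))
          (proj₂ (bounds (⊥ [ j ]≔ inside))))
        (≤-trans (≤-from-gap (proj₁ (bounds (⊥ [ j ]≔ inside)))
          (trans (solve 2 (λ p e → p := :- e :+ (p :+ e)) refl _ _) (+-congˡ (sym q≈p+e))))
          (proj₂ (bounds ⊥)))
        where
        q≈p+e = vertex-insert P ⊥ j (lookup-⊥ j) (suc (suc i))
        bounds : ∀ T → 0# ≤ vertex P T (suc (suc i)) × vertex P T (suc (suc i)) ≤ 1#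
        bounds T = proj₂ (vertices∈A T) (suc (suc i))

      -- Of the two edges from ⊥ to {k} and from {j} to {j,k}, one has both its
      -- ends at x₀ ≥ ∣ edge j zero ∣.
      ∣edge*edge∣≤c : ∀ j k → k ≢ j → ∣ edge j zero * edge k (suc zero) ∣ ≤ c
      ∣edge*edge∣≤c j k k≢j = by-sign (≤-total 0# (edge j zero))
        where
        J K JK : Subset (suc (suc m))
        J  = ⊥ [ j ]≔ inside
        K  = ⊥ [ k ]≔ inside
        JK = J [ k ]≔ inside
        J≈ : ∀ i → vertex P J i ≈ vertex P ⊥ i + edge j i
        J≈ = vertex-insert P ⊥ j (lookup-⊥ j)
        K≈ : ∀ i → vertex P K i ≈ vertex P ⊥ i + edge k i
        K≈ = vertex-insert P ⊥ k (lookup-⊥ k)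
        JK≈J+k : ∀ i → vertex P JK i ≈ vertex P J i + edge k i
        JK≈J+k = vertex-insert P J k (≡.trans (lookup∘update′ k≢j ⊥ inside) (lookup-⊥ k))
        JK≈K+j : ∀ i → vertex P JK i ≈ vertex P K i + edge j i
        JK≈K+j i = trans
          (reflexive (≡.cong (λ T → vertex P T i) ([]≔-commutes ⊥ j k (k≢j ∘ ≡.sym))))
          (vertex-insert P K j (≡.trans (lookup∘update′ (k≢j ∘ ≡.sym) ⊥ inside) (lookup-⊥ j)) i)
        0≤₀ : ∀ T → 0# ≤ vertex P T zero
        0≤₀ T = 0≤x₀ {vertex P T} (vertices∈A T)
        by-sign : 0# ≤ edge j zero ⊎ edge j zero ≤ 0# → ∣ edge j zero * edge k (suc zero) ∣ ≤ c
        -- Adding edge `j` to the vertices at `⊥` and `K`, where x₀ is nonnegative, leads to `J` and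
        -- `JK`. In the opposite case the edge is traversed backwards, and the ends are `⊥` and `K`.
        by-sign (inj₁ 0≤e) = ∣s*t∣≤c {vertex P J} {vertex P JK} (vertices∈A J) (vertices∈A JK) 0≤e
          (≤-from-gap (0≤₀ ⊥) (trans (J≈ zero) (+-comm _ _)))
          (≤-from-gap (0≤₀ K) (trans (JK≈K+j zero) (+-comm _ _)))
          (JK≈J+k (suc zero))
        by-sign (inj₂ e≤0) = begin
          ∣ edge j zero * edge k (suc zero) ∣        ≤⟨ ∣∣-cong (solve 2 (λ s t → s :* t := :- (:- s :* t))
                                                          refl _ _) ⟩
          ∣ - (- edge j zero * edge k (suc zero)) ∣  ≤⟨ ∣-x∣≤∣x∣ _ ⟩
          ∣ - edge j zero * edge k (suc zero) ∣
            ≤⟨ ∣s*t∣≤c {vertex P ⊥} {vertex P K} (vertices∈A ⊥) (vertices∈A K) (neg-nonneg e≤0)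
                 (back ⊥ J (0≤₀ J) (J≈ zero)) (back K JK (0≤₀ JK) (JK≈K+j zero)) (K≈ (suc zero)) ⟩
          c ∎
          where
          back : ∀ S T → 0# ≤ vertex P T zero → vertex P T zero ≈ vertex P S zero + edge j zero →
                 - edge j zero ≤ vertex P S zero
          back S T 0≤q q≈p+e = ≤-from-gap 0≤q
            (trans (solve 2 (λ p e → p := :- e :+ (p :+ e)) refl _ _) (+-congˡ (sym q≈p+e)))

      volume≤c*factorial : volume P ≤ c * factorial (suc (suc m))
      -- The rows of `transpose edge` are indexed by coordinates, so the two rows singled out are
      -- those of x₀ and x₁.
      volume≤c*factorial = ∣det∣≤c*factorial (transpose edge) ∣edge*edge∣≤c ∣edge∣≤1

theorem7 : ExcludedMiddle 0ℓ → (R : CompleteOrderedField) →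
    let open Euclidean R in
    (n : ℕ) → 2 ℕ.≤ n → (ε : ℝ) → 0# < ε →
    ∃[ A ] (A Respects (_≋_ {n})) × JordanMeasurable A × InfiniteVolume A ×
    ((P : Parallelotope n) → (∀ T → vertex P T ∈ A) → volume P < ε)
theorem7 em R (suc (suc m)) (s≤s (s≤s z≤n)) ε 0<ε =
  let c , 0<c , c*n!<ε = small-factor (factorial-nonneg (suc (suc m))) 0<ε in
  staircase c 0<c m ,
  (λ {x} {y} → staircase-resp c 0<c m {x} {y}) ,
  staircase-jordanMeasurable c 0<c m ,
  staircase-infiniteVolume c 0<c m ,
  λ P vertices∈A → ≤-<-trans (volume≤c*factorial 0<c P vertices∈A) c*n!<ε
  where
  open OrderedField R
  open Determinants R
  open Staircase em R
  open Volumes em R
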